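{- Let $p$ be an odd prime and let $A\subset \mathbb{F}_p$ with $|A|\le p^{9/16}$. Define \[F_2(A)=\{\mathrm{Det}(X-Y): X,Y\in M_2(A)\},\qquad G_2(A)=\{\mathrm{Per}(X-Y): X,Y\in M_2(A)\}.\] Then \[|F_2(A)|\gtrsim |A|^{\frac{7}{4}+\frac{1}{60}}\quad\text{and}\quad |G_2(A)|\gtrsim |A|^{\frac{7}{4}+\frac{1}{60}}.\]
   Context: $M_2(A)$ denotes the set of $2\times 2$ matrices with all entries in $A$; for a $2\times 2$ matrix $\begin{bmatrix}a&b\\c&d\end{bmatrix}$, $\mathrm{Det}=ad-bc$ and $\mathrm{Per}=ad+bc$. The notation $U\gtrsim V$ means $U\gg (\log U)^{ -c}V$ for some positive constant $c$, where $U\gg W$ means $W\le c'U$ for some absolute constant $c'>0$. -}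

module Defs where

open import Data.Nat as ℕ using (ℕ; NonZero)
open import Data.Nat.Primality using (Prime; prime⇒nonZero)
open import Data.Fin using (Fin; toℕ)
open import Data.Fin.Properties using () renaming (_≟_ to _≟ᶠ_)
open import Data.Integer as ℤ using (ℤ; +_; _%ℕ_)
open import Data.List using (List; map; cartesianProduct; deduplicate; length)
open import Data.Product using (_×_; _,_)
import Data.Product

-- Elements of F_p are represented by Fin p (residues 0..p-1).
-- A 2x2 matrix [a b; c d] with entries in A is a 4-tuple (a , b , c , d).
M2 : ℕ → Set
M2 p = Fin p × Fin p × Fin p × Fin p

M2-of : {p : ℕ} → List (Fin p) → List (M2 p)
M2-of A = cartesianProduct A (cartesianProduct A (cartesianProduct A A))

ι : {p : ℕ} → Fin p → ℤ
ι x = + toℕ x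

detDiff : {p : ℕ} → M2 p → M2 p → ℤ
detDiff (a , b , c , d) (e , f , g , h) =
  (ι a ℤ.- ι e) ℤ.* (ι d ℤ.- ι h) ℤ.- (ι b ℤ.- ι f) ℤ.* (ι c ℤ.- ι g)

perDiff : {p : ℕ} → M2 p → M2 p → ℤ
perDiff (a , b , c , d) (e , f , g , h) =
  (ι a ℤ.- ι e) ℤ.* (ι d ℤ.- ι h) ℤ.+ (ι b ℤ.- ι f) ℤ.* (ι c ℤ.- ι g)

modP : (p : ℕ) → Prime p → ℤ → ℕ
modP p pr z = _%ℕ_ z p {{prime⇒nonZero pr}}

cardF2 : (p : ℕ) → Prime p → List (Fin p) → ℕ
cardF2 p pr A = length (deduplicate ℕ._≟_
  (map (λ XY → modP p pr (detDiff (Data.Product.proj₁ XY) (Data.Product.proj₂ XY)))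
       (cartesianProduct (M2-of A) (M2-of A))))

cardG2 : (p : ℕ) → Prime p → List (Fin p) → ℕ
cardG2 p pr A = length (deduplicate ℕ._≟_
  (map (λ XY → modP p pr (perDiff (Data.Product.proj₁ XY) (Data.Product.proj₂ XY)))
       (cartesianProduct (M2-of A) (M2-of A))))

{-# OPTIONS --safe #-}
-- Put D = A − A; both F₂(A) and G₂(A) equal DD + DD, and |DD + DD| ≥ |A| (|A| − 1) / 2 whenever |A|² ≤ p.
-- Let R be the set of slopes of A × A and S its complement in F_p. For y in S the intercepts b − a y are distinct,
-- so their complete homogeneous polynomials h_j vanish for p − |A|² < j < p − 1. As h_j is a polynomial of degree
-- at most j in y, it vanishes identically once j < |S| (Rédei, Szőnyi). At y = 0 the intercepts are A taken |A|
-- times, hence ∏ (1 − b T)^|A| times a polynomial is 1 + O(T^|S|) of degree at most p; were |R| < |A| (|A| − 1),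
-- applying T d/dT would show that it is 1 + c T^p, so b^p would be constant on A, contradicting Fermat.
-- Two distinct points of A × A have the same intercept for at most one y, so for some y in R there are at most
-- |A|⁴ / (2 |R|) such pairs. Writing y = (c − d) / (a − b), the elements (c − d)(x − x₀) − (a − b)(z − x₀) of DD + DD
-- coincide only for points (x, z) with the same intercept. For |A|² > p replace A by a subset of ⌊√p⌋ elements.
module Submission where

open import Defs
open import Data.Nat using (ℕ; _*_; _^_; _≤_; _+_)
open import Data.Nat.Primality using (Prime; euclidsLemma; prime⇒nonTrivial; prime⇒nonZero)
open import Data.Nat.Logarithm using (⌈log₂_⌉)
open import Data.Fin using (Fin)
open import Data.List using (List; length)
open import Data.List.Relation.Unary.Unique.Propositional using (Unique)
open import Data.Product using (Σ; ∃; _×_; _,_; proj₁; proj₂)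
open import Relation.Binary.PropositionalEquality using (_≢_)

open import Data.Nat as ℕ using (zero; suc; _∸_; _<_; z≤n; s≤s; _!)
import Data.Nat.Properties as ℕₚ
import Data.Nat.Divisibility as ℕ∣
import Data.Nat.Tactic.RingSolver as ℕR
open import Data.Nat.Combinatorics using (_C_; nCn≡1; nCk≡n!/k![n-k]!; k![n∸k]!∣n!)
open import Data.Nat.DivMod using (m/n*n≡m)
open import Data.Nat.ListAction using (sum)
open import Data.Integer as ℤ using (ℤ; +_; -_; 0ℤ; 1ℤ)
  renaming (_+_ to _⊕_; _*_ to _⊗_; _-_ to _⊝_; _^_ to _⋆_)
import Data.Integer.Properties as ℤₚ
open import Data.Integer.Divisibility.Signed
  using (_∣_; _∣?_; divides; ∣ᵤ⇒∣; ∣⇒∣ᵤ; ∣m∣n⇒∣m+n; ∣m∣n⇒∣m-n; ∣m⇒∣-m; ∣m⇒∣m*n; ∣n⇒∣m*n)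
open import Data.Integer.DivMod using (a≡a%ℕn+[a/ℕn]*n)
open import Data.Integer.Tactic.RingSolver using (solve-∀)
open import Data.Fin as Fin using (toℕ; inject₁; fromℕ)
open import Data.Fin.Properties using (toℕ<n; toℕ-fromℕ; toℕ-inject₁; toℕ-injective)
open import Data.List using ([]; _∷_; [_]; _++_; foldr; map; cartesianProduct; filter; allFin; take)
open import Data.List.Properties
  using (map-++; map-∘; map-cong; map-id; foldr-++; length-map; length-++; length-tabulate; length-take)
open import Data.List.Membership.Propositional using (_∈_; find; lose)
open import Data.List.Membership.Propositional.Properties
  using (∈-∃++; ∈-++⁻; ∈-++⁺ˡ; ∈-++⁺ʳ; ∈-map⁺; ∈-filter⁻; ∈-deduplicate⁺; ∈-cartesianProduct⁺; ∈-cartesianProduct⁻)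
open import Data.List.Relation.Unary.Any using (here; there; any?)
open import Data.List.Relation.Unary.All as All using (All; []; _∷_)
open import Data.List.Relation.Unary.All.Properties using (all-filter; ¬Any⇒All¬) renaming (map⁺ to All-map⁺)
open import Data.List.Relation.Unary.AllPairs as AllPairs using (AllPairs; []; _∷_; allPairs?)
import Data.List.Relation.Unary.AllPairs.Properties as AllPairsₚ
import Data.List.Relation.Unary.Unique.Propositional.Properties as Uniqueₚ
open import Data.Sum using (_⊎_; inj₁; inj₂)
open import Function using (_∘_)
open import Relation.Nullary using (¬_; Dec; yes; no; contradiction; ¬?)
open import Relation.Unary using (Decidable)
open import Relation.Binary.PropositionalEquality
  using (_≡_; _≗_; refl; sym; trans; cong; cong₂; subst; subst₂; module ≡-Reasoning)
import Algebra.Properties.CommutativeSemiring.Binomial ℕₚ.+-*-commutativeSemiring as Binomial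
import Algebra.Properties.Semiring.Sum ℕₚ.+-*-semiring as Sum
import Algebra.Properties.Semiring.Exp ℕₚ.+-*-semiring as Exp
import Algebra.Properties.Semiring.Mult ℕₚ.+-*-semiring as Mult

-- Finite sums, powers and factorials

∣-sum : ∀ {d n} (t : Fin n → ℕ) → (∀ i → d ℕ∣.∣ t i) → d ℕ∣.∣ Sum.sum t
∣-sum {n = zero}  t d∣t = _ ℕ∣.∣0
∣-sum {n = suc n} t d∣t = ℕ∣.∣m∣n⇒∣m+n (d∣t Fin.zero) (∣-sum (t ∘ Fin.suc) (d∣t ∘ Fin.suc))

Exp≡^ : ∀ x n → x Exp.^ n ≡ x ^ n
Exp≡^ x zero    = refl
Exp≡^ x (suc n) = cong (x *_) (Exp≡^ x n)

×≡* : ∀ n x → n Mult.× x ≡ n * x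
×≡* zero x = refl
×≡* (suc n) x = cong (x ℕ.+_) (×≡* n x)

⋆-pos : ∀ x n → (+ x) ⋆ n ≡ + (x ^ n)
⋆-pos x zero    = refl
⋆-pos x (suc n) = trans (cong (+ x ⊗_) (⋆-pos x n)) (sym (ℤₚ.pos-* x (x ^ n)))

n∣n! : ∀ n .{{_ : ℕ.NonZero n}} → n ℕ∣.∣ n !
n∣n! (suc n) = ℕ∣.m∣m*n (n !)

-- Formal power series and products of linear factors 1 - u T

Seq : Set
Seq = ℕ → ℤ

δ : Seq
δ zero    = 1ℤ
δ (suc _) = 0ℤ

shift : Seq → Seq
shift s zero    = 0ℤ
shift s (suc j) = s j

_⊞_ : Seq → Seq → Seq
(s ⊞ t) j = s j ⊕ t j

-- A sequence stands for the power series ∑ sⱼ Tʲ; B u multiplies it by 1 − u T and I u divides it by 1 − u T.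
B I : ℤ → Seq → Seq
B u s j = s j ⊝ u ⊗ shift s j
I u s zero    = s zero
I u s (suc j) = s (suc j) ⊕ u ⊗ I u s j

Bs : List ℤ → Seq → Seq
Bs us s = foldr B s us

-- complete homogeneous symmetric polynomials
h : List ℤ → Seq
h = foldr I δ

shift-cong : ∀ {s t} → s ≗ t → shift s ≗ shift t
shift-cong eq zero    = refl
shift-cong eq (suc j) = eq j

B-cong : ∀ u {s t} → s ≗ t → B u s ≗ B u t
B-cong u eq j = cong₂ (λ x y → x ⊝ u ⊗ y) (eq j) (shift-cong eq j)

Bs-cong : ∀ us {s t} → s ≗ t → Bs us s ≗ Bs us t
Bs-cong []       eq = eq
Bs-cong (u ∷ us) eq = B-cong u (Bs-cong us eq)

B-⊞ : ∀ u s t → B u (s ⊞ t) ≗ B u s ⊞ B u t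
B-⊞ u s t zero    = alg u (s 0) (t 0)
  where alg : ∀ u x y → (x ⊕ y) ⊝ u ⊗ 0ℤ ≡ (x ⊝ u ⊗ 0ℤ) ⊕ (y ⊝ u ⊗ 0ℤ)
        alg = solve-∀
B-⊞ u s t (suc j) = alg u (s (suc j)) (t (suc j)) (s j) (t j)
  where alg : ∀ u x y v w → (x ⊕ y) ⊝ u ⊗ (v ⊕ w) ≡ (x ⊝ u ⊗ v) ⊕ (y ⊝ u ⊗ w)
        alg = solve-∀

Bs-⊞ : ∀ us s t → Bs us (s ⊞ t) ≗ Bs us s ⊞ Bs us t
Bs-⊞ []       s t j = refl
Bs-⊞ (u ∷ us) s t j = trans (B-cong u (Bs-⊞ us s t) j) (B-⊞ u (Bs us s) (Bs us t) j)

B-comm : ∀ u v s → B u (B v s) ≗ B v (B u s)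
B-comm u v s zero          = alg u v (s 0)
  where alg : ∀ u v x → (x ⊝ v ⊗ 0ℤ) ⊝ u ⊗ 0ℤ ≡ (x ⊝ u ⊗ 0ℤ) ⊝ v ⊗ 0ℤ
        alg = solve-∀
B-comm u v s (suc j) = alg u v (s (suc j)) (s j) (shift s j)
  where alg : ∀ u v x y z → (x ⊝ v ⊗ y) ⊝ u ⊗ (y ⊝ v ⊗ z) ≡ (x ⊝ u ⊗ y) ⊝ v ⊗ (y ⊝ u ⊗ z)
        alg = solve-∀

Bs-B : ∀ us u s → Bs us (B u s) ≗ B u (Bs us s)
Bs-B []       u s j = refl
Bs-B (v ∷ us) u s j = trans (B-cong v (Bs-B us u s) j) (B-comm v u (Bs us s) j)

B-I : ∀ u s → B u (I u s) ≗ s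
B-I u s zero    = alg u (s 0)
  where alg : ∀ u x → x ⊝ u ⊗ 0ℤ ≡ x
        alg = solve-∀
B-I u s (suc j) = alg (s (suc j)) (u ⊗ I u s j)
  where alg : ∀ x y → (x ⊕ y) ⊝ y ≡ x
        alg = solve-∀

-- So `h us` is the inverse of the product of all 1 - u T. The factors commute, hence the outermost
-- `B u` can be moved inward until it meets its own `I u`.
Bs-h : ∀ us → Bs us (h us) ≗ δ
Bs-h []       j = refl
Bs-h (u ∷ us) j = begin
  B u (Bs us (I u (h us))) j   ≡⟨ Bs-B us u (I u (h us)) j ⟨
  Bs us (B u (I u (h us))) j   ≡⟨ Bs-cong us (B-I u (h us)) j ⟩
  Bs us (h us) j               ≡⟨ Bs-h us j ⟩
  δ j                          ∎
  where open ≡-Reasoning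

-- Polynomials of degree less than d. The coefficients are zero as integers, not merely modulo p, so
-- degree bounds need no reduction.
Below : ℕ → Seq → Set
Below d s = ∀ j → d ≤ j → s j ≡ 0ℤ

0⊝u⊗0 : ∀ u → 0ℤ ⊝ u ⊗ 0ℤ ≡ 0ℤ
0⊝u⊗0 = solve-∀

B-below : ∀ {d s} u → Below d s → Below (suc d) (B u s)
B-below u b (suc j) (s≤s d≤j) =
  trans (cong₂ (λ x y → x ⊝ u ⊗ y) (b (suc j) (ℕₚ.m≤n⇒m≤1+n d≤j)) (b j d≤j)) (0⊝u⊗0 u)

Bs-below : ∀ {d s} us → Below d s → Below (length us + d) (Bs us s)
Bs-below []       b = b
Bs-below (u ∷ us) b = B-below u (Bs-below us b)

Bs-pow : List ℤ → ℕ → Seq → Seq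
Bs-pow us zero    s = s
Bs-pow us (suc k) s = Bs us (Bs-pow us k s)

Bs-pow-cong : ∀ us k {s t} → s ≗ t → Bs-pow us k s ≗ Bs-pow us k t
Bs-pow-cong us zero    eq = eq
Bs-pow-cong us (suc k) eq = Bs-cong us (Bs-pow-cong us k eq)

Bs-pow-below : ∀ {d s} us k → Below d s → Below (k * length us + d) (Bs-pow us k s)
Bs-pow-below us zero    b = b
Bs-pow-below {d} {s} us (suc k) b =
  subst (λ e → Below e (Bs-pow us (suc k) s)) (sym (ℕₚ.+-assoc (length us) (k * length us) d))
    (Bs-below us (Bs-pow-below us k b))

Bs-pow-⊞ : ∀ us k s t → Bs-pow us k (s ⊞ t) ≗ Bs-pow us k s ⊞ Bs-pow us k t
Bs-pow-⊞ us zero    s t j = refl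
Bs-pow-⊞ us (suc k) s t j =
  trans (Bs-cong us (Bs-pow-⊞ us k s t) j) (Bs-⊞ us (Bs-pow us k s) (Bs-pow us k t) j)

-- The derivation T d/dT on products

-- θ is the derivation T d/dT, and M us multiplies by θ (∏ (1 − u T)); note θ (1 − u T) = (1 − u T) − 1.
θ : Seq → Seq
θ s j = + j ⊗ s j

Δ : ℤ → Seq → Seq
Δ u s j = B u s j ⊝ s j

M : List ℤ → Seq → Seq
M []       s j = 0ℤ
M (u ∷ us) s   = Δ u (Bs us s) ⊞ B u (M us s)

-- Leibniz rule; `Δ u` is multiplication by - u T, which is θ (1 - u T).
θ-B : ∀ u s → θ (B u s) ≗ B u (θ s) ⊞ Δ u s
θ-B u s zero    = alg u (s 0)
  where alg : ∀ u x → 0ℤ ⊗ (x ⊝ u ⊗ 0ℤ) ≡ (0ℤ ⊗ x ⊝ u ⊗ 0ℤ) ⊕ ((x ⊝ u ⊗ 0ℤ) ⊝ x)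
        alg = solve-∀
θ-B u s (suc j) = alg u (+ j) (s (suc j)) (s j)
  where alg : ∀ u n x y → (1ℤ ⊕ n) ⊗ (x ⊝ u ⊗ y) ≡ ((1ℤ ⊕ n) ⊗ x ⊝ u ⊗ (n ⊗ y)) ⊕ ((x ⊝ u ⊗ y) ⊝ x)
        alg = solve-∀

Δ-cong : ∀ u {s t} → s ≗ t → Δ u s ≗ Δ u t
Δ-cong u eq j = cong₂ _⊝_ (B-cong u eq j) (eq j)

Δ-B : ∀ u v s → Δ u (B v s) ≗ B v (Δ u s)
Δ-B u v s zero    = alg u v (s 0)
  where alg : ∀ u v x → ((x ⊝ v ⊗ 0ℤ) ⊝ u ⊗ 0ℤ) ⊝ (x ⊝ v ⊗ 0ℤ) ≡ ((x ⊝ u ⊗ 0ℤ) ⊝ x) ⊝ v ⊗ 0ℤ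
        alg = solve-∀
Δ-B u v s (suc j) = alg u v (s (suc j)) (s j) (shift s j)
  where alg : ∀ u v x y z → ((x ⊝ v ⊗ y) ⊝ u ⊗ (y ⊝ v ⊗ z)) ⊝ (x ⊝ v ⊗ y)
                          ≡ ((x ⊝ u ⊗ y) ⊝ x) ⊝ v ⊗ ((y ⊝ u ⊗ z) ⊝ y)
        alg = solve-∀

M-B : ∀ us v s → M us (B v s) ≗ B v (M us s)
M-B []       v s zero    = sym (0⊝u⊗0 v)
M-B []       v s (suc j) = sym (0⊝u⊗0 v)
M-B (u ∷ us) v s j = begin
  Δ u (Bs us (B v s)) j ⊕ B u (M us (B v s)) j
    ≡⟨ cong₂ _⊕_ (Δ-cong u (Bs-B us v s) j) (B-cong u (M-B us v s) j) ⟩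
  Δ u (B v (Bs us s)) j ⊕ B u (B v (M us s)) j
    ≡⟨ cong₂ _⊕_ (Δ-B u v (Bs us s) j) (B-comm u v (M us s) j) ⟩
  B v (Δ u (Bs us s)) j ⊕ B v (B u (M us s)) j
    ≡⟨ B-⊞ v (Δ u (Bs us s)) (B u (M us s)) j ⟨
  B v (M (u ∷ us) s) j ∎
  where open ≡-Reasoning

M-cong : ∀ us {s t} → s ≗ t → M us s ≗ M us t
M-cong []       eq j = refl
M-cong (u ∷ us) eq j = cong₂ _⊕_ (Δ-cong u (Bs-cong us eq) j) (B-cong u (M-cong us eq) j)

M-Bs : ∀ us vs s → M us (Bs vs s) ≗ Bs vs (M us s)
M-Bs us []       s j = refl
M-Bs us (v ∷ vs) s j = trans (M-B us v (Bs vs s) j) (B-cong v (M-Bs us vs s) j)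

M-Bs-pow : ∀ us vs k s → M us (Bs-pow vs k s) ≗ Bs-pow vs k (M us s)
M-Bs-pow us vs zero    s j = refl
M-Bs-pow us vs (suc k) s j =
  trans (M-Bs us vs (Bs-pow vs k s) j) (Bs-cong vs (M-Bs-pow us vs k s) j)

M-below : ∀ {d s} us → Below d s → Below (length us + d) (M us s)
M-below []       b j _ = refl
M-below {d} (u ∷ us) b j le = cong₂ _⊕_
  (cong₂ _⊝_ (B-below u (Bs-below us b) j le)
             (Bs-below us b j (ℕₚ.≤-trans (ℕₚ.n≤1+n _) le)))
  (B-below u (M-below us b) j le)

θ-Bs : ∀ us s → θ (Bs us s) ≗ Bs us (θ s) ⊞ M us s
θ-Bs []       s j = sym (ℤₚ.+-identityʳ _)
θ-Bs (u ∷ us) s j = begin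
  θ (B u (Bs us s)) j                                            ≡⟨ θ-B u (Bs us s) j ⟩
  B u (θ (Bs us s)) j ⊕ Δ u (Bs us s) j                          ≡⟨ cong (_⊕ Δ u (Bs us s) j) (B-cong u (θ-Bs us s) j) ⟩
  B u (Bs us (θ s) ⊞ M us s) j ⊕ Δ u (Bs us s) j                 ≡⟨ cong (_⊕ Δ u (Bs us s) j) (B-⊞ u (Bs us (θ s)) (M us s) j) ⟩
  (B u (Bs us (θ s)) j ⊕ B u (M us s) j) ⊕ Δ u (Bs us s) j       ≡⟨ alg (B u (Bs us (θ s)) j) (B u (M us s) j) (Δ u (Bs us s) j) ⟩
  B u (Bs us (θ s)) j ⊕ (Δ u (Bs us s) j ⊕ B u (M us s) j)       ∎
  where
  open ≡-Reasoning
  alg : ∀ x y z → (x ⊕ y) ⊕ z ≡ x ⊕ (z ⊕ y)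
  alg = solve-∀

θ-below : ∀ {d s} → Below d s → Below d (θ s)
θ-below b j le = trans (cong (+ j ⊗_) (b j le)) (ℤₚ.*-zeroʳ (+ j))

-- The multiplicity of a factor drops by at most one under θ.
θ-Bs-pow : ∀ {d} us k s → Below d s →
  ∃ λ r → Below (length us + d) r × θ (Bs-pow us (suc k) s) ≗ Bs-pow us k r
θ-Bs-pow us zero s b =
  Bs us (θ s) ⊞ M us s ,
  (λ j le → cong₂ _⊕_ (Bs-below us (θ-below b) j le) (M-below us b j le)) ,
  θ-Bs us s
θ-Bs-pow us (suc k) s b with θ-Bs-pow us k s b
... | r , below-r , eq = r ⊞ M us s ,
  (λ j le → cong₂ _⊕_ (below-r j le) (M-below us b j le)) ,
  λ j → begin
    θ (Bs us P) j                                         ≡⟨ θ-Bs us P j ⟩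
    Bs us (θ P) j ⊕ M us P j                              ≡⟨ cong₂ _⊕_ (Bs-cong us eq j) (M-Bs-pow us us (suc k) s j) ⟩
    Bs-pow us (suc k) r j ⊕ Bs-pow us (suc k) (M us s) j  ≡⟨ Bs-pow-⊞ us (suc k) r (M us s) j ⟨
    Bs-pow us (suc k) (r ⊞ M us s) j                      ∎
  where
  open ≡-Reasoning
  P = Bs-pow us (suc k) s

-- Since the factors commute, 1 - u T can be brought to the front. The cofactor has one factor
-- fewer; comparing with `suc j` expresses this lower degree without a predecessor.
factor-out : ∀ {u us d t} → u ∈ us → Below d t →
  ∃ λ s → Bs us t ≗ B u s × (∀ j → length us + d ≤ suc j → s j ≡ 0ℤ)
factor-out {us = u ∷ us} {t = t} (here refl) b = Bs us t , (λ j → refl) , λ { j (s≤s le) → Bs-below us b j le }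
factor-out {u} {v ∷ us} (there u∈) b with factor-out u∈ b
... | s , eq , b′ = B v s , (λ j → trans (B-cong v eq j) (B-comm v u s j)) ,
  λ { (suc j) (s≤s le) → trans (cong₂ (λ x y → x ⊝ v ⊗ y) (b′ (suc j) (ℕₚ.m≤n⇒m≤1+n le)) (b′ j le)) (0⊝u⊗0 v)
    ; zero (s≤s le) → trans (cong (λ x → x ⊝ v ⊗ 0ℤ) (b′ zero (ℕₚ.≤-trans le z≤n))) (0⊝u⊗0 v) }

-- Divided differences

-- Tⁿ times h, where n is the length; entry j is the divided difference of x^(j−1) at the nodes.
H : List ℤ → Seq
H []       = δ
H (u ∷ us) = shift (I u (H us))

I-shift : ∀ u s → I u (shift s) ≗ shift (I u s)
I-shift u s zero          = refl
I-shift u s (suc zero)    = alg u (s 0)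
  where alg : ∀ u x → x ⊕ u ⊗ 0ℤ ≡ x
        alg = solve-∀
I-shift u s (suc (suc j)) = cong (λ x → s (suc j) ⊕ u ⊗ x) (I-shift u s (suc j))

shifts : ℕ → Seq → Seq
shifts zero    s = s
shifts (suc k) s = shift (shifts k s)

I-cong : ∀ u {s t} → s ≗ t → I u s ≗ I u t
I-cong u eq zero    = eq 0
I-cong u eq (suc j) = cong₂ (λ x y → x ⊕ u ⊗ y) (eq (suc j)) (I-cong u eq j)

I-shifts : ∀ u k s → I u (shifts k s) ≗ shifts k (I u s)
I-shifts u zero    s j = refl
I-shifts u (suc k) s j = trans (I-shift u (shifts k s) j) (shift-cong (I-shifts u k s) j)

H≗shifts-h : ∀ us → H us ≗ shifts (length us) (h us)
H≗shifts-h []       j = refl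
H≗shifts-h (u ∷ us) = shift-cong λ j →
  trans (I-cong u (H≗shifts-h us) j) (I-shifts u (length us) (h us) j)

shifts-+ : ∀ k s j → shifts k s (k + j) ≡ s j
shifts-+ zero    s j = refl
shifts-+ (suc k) s j = shifts-+ k s j

shifts-< : ∀ k s j → j < k → shifts k s j ≡ 0ℤ
shifts-< (suc k) s zero    _        = refl
shifts-< (suc k) s (suc j) (s≤s lt) = shifts-< k s j lt

-- Coefficients of the identity 1/(1 - u T) - 1/(1 - v T) = (u - v) T / ((1 - u T)(1 - v T)),
-- applied to s.
I-divided-difference : ∀ u v s j → I u s (suc j) ⊝ I v s (suc j) ≡ (u ⊝ v) ⊗ I u (I v s) j
I-divided-difference u v s zero    = alg u v (s 1) (s 0)
  where alg : ∀ u v x y → (x ⊕ u ⊗ y) ⊝ (x ⊕ v ⊗ y) ≡ (u ⊝ v) ⊗ y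
        alg = solve-∀
I-divided-difference u v s (suc j) = begin
  (x ⊕ u ⊗ a) ⊝ (x ⊕ v ⊗ b)      ≡⟨ alg₁ u v x a b ⟩
  u ⊗ (a ⊝ b) ⊕ (u ⊝ v) ⊗ b      ≡⟨ cong (λ z → u ⊗ z ⊕ (u ⊝ v) ⊗ b) (I-divided-difference u v s j) ⟩
  u ⊗ ((u ⊝ v) ⊗ c) ⊕ (u ⊝ v) ⊗ b ≡⟨ alg₂ u v c b ⟩
  (u ⊝ v) ⊗ (b ⊕ u ⊗ c)           ∎
  where
  open ≡-Reasoning
  x = s (suc (suc j)); a = I u s (suc j); b = I v s (suc j); c = I u (I v s) j
  alg₁ : ∀ u v x a b → (x ⊕ u ⊗ a) ⊝ (x ⊕ v ⊗ b) ≡ u ⊗ (a ⊝ b) ⊕ (u ⊝ v) ⊗ b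
  alg₁ = solve-∀
  alg₂ : ∀ u v c b → u ⊗ ((u ⊝ v) ⊗ c) ⊕ (u ⊝ v) ⊗ b ≡ (u ⊝ v) ⊗ (b ⊕ u ⊗ c)
  alg₂ = solve-∀

I-δ : ∀ u j → I u δ j ≡ u ⋆ j
I-δ u zero    = refl
I-δ u (suc j) = trans (ℤₚ.+-identityˡ _) (cong (u ⊗_) (I-δ u j))

-- Integer polynomial functions in Horner form

data Polynomial : ℕ → (ℤ → ℤ) → Set where
  -- Allowed at every d, so that d only bounds the degree from above.
  constant : ∀ {d φ} c → (∀ y → φ y ≡ c) → Polynomial d φ
  horner   : ∀ {d φ ψ} c → Polynomial d ψ → (∀ y → φ y ≡ c ⊕ y ⊗ ψ y) → Polynomial (suc d) φ

poly-≗ : ∀ {d φ ψ} → φ ≗ ψ → Polynomial d ψ → Polynomial d φ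
poly-≗ eq (constant c e) = constant c λ y → trans (eq y) (e y)
poly-≗ eq (horner c P e) = horner c P λ y → trans (eq y) (e y)

poly-weaken : ∀ {d φ} → Polynomial d φ → Polynomial (suc d) φ
poly-weaken (constant c e) = constant c e
poly-weaken (horner c P e) = horner c (poly-weaken P) e

poly-+ : ∀ {d φ ψ} → Polynomial d φ → Polynomial d ψ → Polynomial d (λ y → φ y ⊕ ψ y)
poly-+ (constant c e) (constant c′ e′) = constant (c ⊕ c′) λ y → cong₂ _⊕_ (e y) (e′ y)
poly-+ (constant c e) (horner {ψ = ψ} c′ P′ e′) = horner (c ⊕ c′) P′ λ y →
  trans (cong₂ _⊕_ (e y) (e′ y)) (sym (ℤₚ.+-assoc c c′ (y ⊗ ψ y)))
poly-+ (horner {ψ = ψ} c P e) (constant c′ e′) = horner (c ⊕ c′) P λ y →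
  trans (cong₂ _⊕_ (e y) (e′ y)) (alg c (y ⊗ ψ y) c′)
  where alg : ∀ c x c′ → (c ⊕ x) ⊕ c′ ≡ (c ⊕ c′) ⊕ x
        alg = solve-∀
poly-+ (horner {ψ = ψ} c P e) (horner {ψ = ψ′} c′ P′ e′) = horner (c ⊕ c′) (poly-+ P P′) λ y →
  trans (cong₂ _⊕_ (e y) (e′ y)) (alg c c′ y (ψ y) (ψ′ y))
  where alg : ∀ c c′ y a b → (c ⊕ y ⊗ a) ⊕ (c′ ⊕ y ⊗ b) ≡ (c ⊕ c′) ⊕ y ⊗ (a ⊕ b)
        alg = solve-∀

poly-scale : ∀ {d φ} k → Polynomial d φ → Polynomial d (λ y → k ⊗ φ y)
poly-scale k (constant c e) = constant (k ⊗ c) λ y → cong (k ⊗_) (e y)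
poly-scale k (horner {ψ = ψ} c P e) = horner (k ⊗ c) (poly-scale k P) λ y →
  trans (cong (k ⊗_) (e y)) (alg k c y (ψ y))
  where alg : ∀ k c y a → k ⊗ (c ⊕ y ⊗ a) ≡ k ⊗ c ⊕ y ⊗ (k ⊗ a)
        alg = solve-∀

poly-linear : ∀ {d φ} a b → Polynomial d φ → Polynomial (suc d) (λ y → (b ⊝ a ⊗ y) ⊗ φ y)
poly-linear {φ = φ} a b P = poly-≗ (λ y → alg a b y (φ y))
  (poly-+ (poly-weaken (poly-scale b P)) (horner 0ℤ (poly-scale (- a) P) λ y → refl))
  where alg : ∀ a b y x → (b ⊝ a ⊗ y) ⊗ x ≡ b ⊗ x ⊕ (0ℤ ⊕ y ⊗ (- a ⊗ x))
        alg = solve-∀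

-- In the recursion h_(j+1)(u, us) = h_(j+1)(us) + u h_j(u, us) the node u = b - a y is linear in y,
-- so each increase of the index raises the degree by at most one.
h-polynomial : ∀ (ps : List (ℤ × ℤ)) j →
  Polynomial j (λ y → h (map (λ (a , b) → b ⊝ a ⊗ y) ps) j)
h-polynomial []       zero    = constant 1ℤ λ _ → refl
h-polynomial []       (suc j) = constant 0ℤ λ _ → refl
h-polynomial (_ ∷ ps) zero    = h-polynomial ps zero
h-polynomial ((a , b) ∷ ps) (suc j) =
  poly-+ (h-polynomial ps (suc j)) (poly-linear a b (h-polynomial ((a , b) ∷ ps) j))

-- Synthetic division. As y - r is monic, it is exact over the integers, and reduction modulo p can
-- wait until roots are counted.
poly-factor : ∀ {d φ} r → Polynomial (suc d) φ →
  ∃ λ χ → Polynomial d χ × ∀ y → φ y ≡ φ r ⊕ (y ⊝ r) ⊗ χ y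
poly-factor r (constant c e) = (λ _ → 0ℤ) , constant 0ℤ (λ _ → refl) , λ y →
  trans (e y) (trans (alg c y r) (cong (_⊕ (y ⊝ r) ⊗ 0ℤ) (sym (e r))))
  where alg : ∀ c y r → c ≡ c ⊕ (y ⊝ r) ⊗ 0ℤ
        alg = solve-∀
poly-factor r (horner {ψ = ψ} c (constant c′ e′) e) = ψ , constant c′ e′ , λ y →
  trans (e y) (trans (cong (λ x → c ⊕ y ⊗ x) (e′ y))
    (trans (alg c y r c′) (sym (cong₂ (λ x z → x ⊕ (y ⊝ r) ⊗ z) (trans (e r) (cong (λ x → c ⊕ r ⊗ x) (e′ r))) (e′ y)))))
  where alg : ∀ c y r a → c ⊕ y ⊗ a ≡ (c ⊕ r ⊗ a) ⊕ (y ⊝ r) ⊗ a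
        alg = solve-∀
poly-factor {φ = φ} r (horner {d = suc d} {ψ = ψ} c P@(horner _ _ _) e) with poly-factor r P
... | χ , Q , e′ = (λ y → ψ y ⊕ r ⊗ χ y) , poly-+ P (poly-weaken (poly-scale r Q)) , λ y → begin
  φ y                                               ≡⟨ e y ⟩
  c ⊕ y ⊗ ψ y                                       ≡⟨ alg₁ c y r (ψ y) ⟩
  (c ⊕ r ⊗ ψ y) ⊕ (y ⊝ r) ⊗ ψ y                     ≡⟨ cong (λ x → (c ⊕ r ⊗ x) ⊕ (y ⊝ r) ⊗ ψ y) (e′ y) ⟩
  (c ⊕ r ⊗ (ψ r ⊕ (y ⊝ r) ⊗ χ y)) ⊕ (y ⊝ r) ⊗ ψ y   ≡⟨ alg₂ c y r (ψ r) (ψ y) (χ y) ⟩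
  (c ⊕ r ⊗ ψ r) ⊕ (y ⊝ r) ⊗ (ψ y ⊕ r ⊗ χ y)         ≡⟨ cong (_⊕ (y ⊝ r) ⊗ (ψ y ⊕ r ⊗ χ y)) (e r) ⟨
  φ r ⊕ (y ⊝ r) ⊗ (ψ y ⊕ r ⊗ χ y)                   ∎
  where
  open ≡-Reasoning
  alg₁ : ∀ c y r a → c ⊕ y ⊗ a ≡ (c ⊕ r ⊗ a) ⊕ (y ⊝ r) ⊗ a
  alg₁ = solve-∀
  alg₂ : ∀ c y r a b x → (c ⊕ r ⊗ (a ⊕ (y ⊝ r) ⊗ x)) ⊕ (y ⊝ r) ⊗ b ≡ (c ⊕ r ⊗ a) ⊕ (y ⊝ r) ⊗ (b ⊕ r ⊗ x)
  alg₂ = solve-∀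

-- Intercepts of the points of a grid

length-cartesianProduct : ∀ {A B : Set} (xs : List A) (ys : List B) →
  length (cartesianProduct xs ys) ≡ length xs * length ys
length-cartesianProduct []       ys = refl
length-cartesianProduct (x ∷ xs) ys = trans (length-++ (map (x ,_) ys))
  (cong₂ _+_ (length-map (x ,_) ys) (length-cartesianProduct xs ys))

intercepts : List ℤ → ℤ → List ℤ
intercepts as y = map (λ (a , b) → b ⊝ a ⊗ y) (cartesianProduct as as)

-- At y = 0 the first coordinate drops out of the intercept, so each entry of `xs` contributes one
-- full copy of `as`.
Bs-intercepts-0 : ∀ xs as s →
  Bs (map (λ (a , b) → b ⊝ a ⊗ 0ℤ) (cartesianProduct xs as)) s ≡ Bs-pow as (length xs) s
Bs-intercepts-0 []       as s = refl
Bs-intercepts-0 (x ∷ xs) as s = begin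
  Bs (map f (map (x ,_) as ++ cartesianProduct xs as)) s            ≡⟨ cong (λ l → Bs l s) (map-++ f (map (x ,_) as) _) ⟩
  Bs (map f (map (x ,_) as) ++ map f (cartesianProduct xs as)) s    ≡⟨ foldr-++ B s (map f (map (x ,_) as)) _ ⟩
  Bs (map f (map (x ,_) as)) (Bs (map f (cartesianProduct xs as)) s)
    ≡⟨ cong₂ Bs (trans (sym (map-∘ as)) (trans (map-cong (alg x) as) (map-id as))) (Bs-intercepts-0 xs as s) ⟩
  Bs as (Bs-pow as (length xs) s)                                   ∎
  where
  open ≡-Reasoning
  f : ℤ × ℤ → ℤ
  f (a , b) = b ⊝ a ⊗ 0ℤ
  alg : ∀ x b → b ⊝ x ⊗ 0ℤ ≡ b
  alg = solve-∀

-- Counting with indicators and collisions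

⟦_⟧ : ∀ {A : Set} → Dec A → ℕ
⟦ yes _ ⟧ = 1
⟦ no  _ ⟧ = 0

⟦⟧-yes : ∀ {A : Set} (d : Dec A) → A → ⟦ d ⟧ ≡ 1
⟦⟧-yes (yes _) _ = refl
⟦⟧-yes (no ¬a) a = contradiction a ¬a

private variable
  X Y : Set

∑ : List X → (X → ℕ) → ℕ
∑ xs f = sum (map f xs)

∑-+ : ∀ (xs : List X) f g → ∑ xs (λ x → f x + g x) ≡ ∑ xs f + ∑ xs g
∑-+ []       f g = refl
∑-+ (x ∷ xs) f g = trans (cong (f x + g x ℕ.+_) (∑-+ xs f g)) (alg (f x) (g x) (∑ xs f) (∑ xs g))
  where alg : ∀ a b c d → (a + b) + (c + d) ≡ (a + c) + (b + d)
        alg = ℕR.solve-∀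

∑-0 : ∀ (xs : List X) → ∑ xs (λ _ → 0) ≡ 0
∑-0 []       = refl
∑-0 (_ ∷ xs) = ∑-0 xs

∑-≤ : ∀ {xs : List X} {c f} → (∀ {x} → x ∈ xs → f x ≤ c) → ∑ xs f ≤ c * length xs
∑-≤ {xs = []}     le = z≤n
∑-≤ {xs = x ∷ xs} {c} {f} le = subst (∑ (x ∷ xs) f ≤_) (sym (ℕₚ.*-suc c (length xs)))
  (ℕₚ.+-mono-≤ (le (here refl)) (∑-≤ (le ∘ there)))

∑-≥ : ∀ {xs : List X} {c f} → (∀ {x} → x ∈ xs → c ≤ f x) → c * length xs ≤ ∑ xs f
∑-≥ {xs = []} {c} le = ℕₚ.≤-reflexive (ℕₚ.*-zeroʳ c)
∑-≥ {xs = x ∷ xs} {c} {f} le = subst (_≤ ∑ (x ∷ xs) f) (sym (ℕₚ.*-suc c (length xs)))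
  (ℕₚ.+-mono-≤ (le (here refl)) (∑-≥ (le ∘ there)))

∑-swap : ∀ (xs : List X) (ys : List Y) (f : X → Y → ℕ) → ∑ xs (λ x → ∑ ys (f x)) ≡ ∑ ys (λ y → ∑ xs (λ x → f x y))
∑-swap xs []       f = ∑-0 xs
∑-swap xs (y ∷ ys) f = trans (∑-+ xs (λ x → f x y) (λ x → ∑ ys (f x))) (cong (∑ xs (λ x → f x y) ℕ.+_) (∑-swap xs ys f))

∑-at-most-one : ∀ {P : X → Set} (P? : ∀ x → Dec (P x)) {xs} → Unique xs →
  (∀ {x y} → P x → P y → x ≡ y) → ∑ xs (λ x → ⟦ P? x ⟧) ≤ 1
∑-at-most-one P? {[]}     _ _ = z≤n
∑-at-most-one P? {x ∷ xs} (x∉xs ∷ uxs) one with P? x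
... | no  _  = ∑-at-most-one P? uxs one
... | yes px = s≤s (∑-≤ {c = 0} λ {y} y∈ → none y∈)
  where
  none : ∀ {y} → y ∈ xs → ⟦ P? y ⟧ ≤ 0
  none {y} y∈ with P? y
  ... | no  _  = z≤n
  ... | yes py = contradiction (one px py) (All.lookup x∉xs y∈)

pairs : List X → ℕ
pairs []       = 0
pairs (_ ∷ xs) = length xs + pairs xs

2*pairs : ∀ (xs : List X) → 2 * pairs xs + length xs ≡ length xs * length xs
2*pairs []       = refl
2*pairs (_ ∷ xs) = trans (alg₁ (length xs) (pairs xs))
  (trans (cong (2 * length xs + 1 ℕ.+_) (2*pairs xs)) (alg₂ (length xs)))
  where
  alg₁ : ∀ n q → 2 * (n + q) + suc n ≡ (2 * n + 1) + (2 * q + n)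
  alg₁ = ℕR.solve-∀
  alg₂ : ∀ n → (2 * n + 1) + n * n ≡ suc n * suc n
  alg₂ = ℕR.solve-∀

module _ {R : X → X → Set} (R? : ∀ x y → Dec (R x y)) where

  collisions : List X → ℕ
  collisions []       = 0
  collisions (x ∷ xs) = ∑ xs (λ y → ⟦ R? x y ⟧) + collisions xs

  allPairs-dichotomy : ∀ {xs} → Unique xs →
    AllPairs (λ x y → ¬ R x y) xs ⊎ ∃ λ x → ∃ λ y → x ∈ xs × y ∈ xs × x ≢ y × R x y
  allPairs-dichotomy {[]} _ = inj₁ []
  allPairs-dichotomy {x ∷ xs} (x∉xs ∷ uxs) with allPairs-dichotomy uxs
  ... | inj₂ (y , z , y∈ , z∈ , y≢z , r) = inj₂ (y , z , there y∈ , there z∈ , y≢z , r)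
  ... | inj₁ ap with any? (R? x) xs
  ...   | no ¬any = inj₁ (¬Any⇒All¬ xs ¬any ∷ ap)
  ...   | yes any with find any
  ...     | y , y∈ , r = inj₂ (x , y , here refl , there y∈ , All.lookup x∉xs y∈ , r)

  -- Each entry is charged once. If a later entry has the same value under `f`, it pays with that
  -- collision; otherwise it pays with its value, which no later entry takes.
  length≤image+collisions : ∀ (f : X → ℕ) → (∀ {x y} → f x ≡ f y → R x y) →
    ∀ xs {zs} → (∀ {x} → x ∈ xs → f x ∈ zs) → length xs ≤ length zs + collisions xs
  length≤image+collisions f inj []       _ = z≤n
  length≤image+collisions f inj (x ∷ xs) {zs} f∈ with any? (λ y → f x ℕ.≟ f y) xs
  ... | yes any with find any
  ...   | y , y∈ , fx≡fy = begin
    suc (length xs)                                     ≤⟨ s≤s (length≤image+collisions f inj xs (f∈ ∘ there)) ⟩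
    suc (length zs + collisions xs)                     ≡⟨ ℕₚ.+-suc (length zs) _ ⟨
    length zs + (1 + collisions xs)                     ≤⟨ ℕₚ.+-monoʳ-≤ (length zs) (ℕₚ.+-monoˡ-≤ (collisions xs) (hit y∈)) ⟩
    length zs + collisions (x ∷ xs)                     ∎
    where
    open ℕₚ.≤-Reasoning
    hit : ∀ {ys} → y ∈ ys → 1 ≤ ∑ ys (λ z → ⟦ R? x z ⟧)
    hit (here refl) = ℕₚ.≤-trans (ℕₚ.≤-reflexive (sym (⟦⟧-yes (R? x y) (inj fx≡fy)))) (ℕₚ.m≤m+n _ _)
    hit (there z∈)  = ℕₚ.≤-trans (hit z∈) (ℕₚ.m≤n+m _ _)
  -- One occurrence of `f x` is removed from `zs`; the values of the later entries remain in what is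
  -- left.
  length≤image+collisions f inj (x ∷ xs) {zs} f∈ | no ¬any with ∈-∃++ (f∈ (here refl))
  ... | ys , ws , refl = begin
    suc (length xs)                                     ≤⟨ s≤s (length≤image+collisions f inj xs f∈′) ⟩
    suc (length (ys ++ ws) + collisions xs)             ≡⟨ cong (_+ collisions xs) length-eq ⟨
    length (ys ++ [ f x ] ++ ws) + collisions xs        ≤⟨ ℕₚ.+-monoʳ-≤ (length (ys ++ [ f x ] ++ ws)) (ℕₚ.m≤n+m _ _) ⟩
    length (ys ++ [ f x ] ++ ws) + collisions (x ∷ xs)  ∎
    where
    open ℕₚ.≤-Reasoning
    length-eq : length (ys ++ [ f x ] ++ ws) ≡ suc (length (ys ++ ws))
    length-eq = trans (length-++ ys) (trans (ℕₚ.+-suc (length ys) (length ws)) (cong suc (sym (length-++ ys))))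
    f∈′ : ∀ {y} → y ∈ xs → f y ∈ ys ++ ws
    f∈′ {y} y∈ with ∈-++⁻ ys (f∈ (there y∈))
    ... | inj₁ ∈ys         = ∈-++⁺ˡ ∈ys
    ... | inj₂ (here eq)   = contradiction (lose y∈ (sym eq)) ¬any
    ... | inj₂ (there ∈ws) = ∈-++⁺ʳ ys ∈ws

-- Double counting: after exchanging the sums, each pair of distinct entries collides for at most
-- one y.
∑-collisions≤pairs : ∀ {R : Y → X → X → Set} (R? : ∀ y x x′ → Dec (R y x x′)) {ys : List Y} {xs : List X} →
  Unique ys → Unique xs → (∀ {x x′ y y′} → x ≢ x′ → R y x x′ → R y′ x x′ → y ≡ y′) →
  ∑ ys (λ y → collisions (R? y) xs) ≤ pairs xs
∑-collisions≤pairs R? {ys} {[]} _ _ _ = ℕₚ.≤-reflexive (∑-0 ys)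
∑-collisions≤pairs R? {ys} {x ∷ xs} uys (x∉xs ∷ uxs) one = begin
  ∑ ys (λ y → ∑ xs (λ z → ⟦ R? y x z ⟧) + collisions (R? y) xs)
    ≡⟨ ∑-+ ys _ _ ⟩
  ∑ ys (λ y → ∑ xs (λ z → ⟦ R? y x z ⟧)) + ∑ ys (λ y → collisions (R? y) xs)
    ≡⟨ cong (_+ ∑ ys (λ y → collisions (R? y) xs)) (∑-swap ys xs (λ y z → ⟦ R? y x z ⟧)) ⟩
  ∑ xs (λ z → ∑ ys (λ y → ⟦ R? y x z ⟧)) + ∑ ys (λ y → collisions (R? y) xs)
    ≤⟨ ℕₚ.+-mono-≤ (∑-≤ {c = 1} λ {z} z∈ → ∑-at-most-one (λ y → R? y x z) uys (one (All.lookup x∉xs z∈)))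
                   (∑-collisions≤pairs R? uys uxs one) ⟩
  1 * length xs + pairs xs
    ≡⟨ cong (_+ pairs xs) (ℕₚ.*-identityˡ (length xs)) ⟩
  pairs (x ∷ xs) ∎
  where open ℕₚ.≤-Reasoning

-- Auxiliary facts on lists, square roots and powers

length-filter-split : ∀ {P : X → Set} (P? : Decidable P) xs →
  length (filter (¬? ∘ P?) xs) + length (filter P? xs) ≡ length xs
length-filter-split P? []       = refl
length-filter-split P? (x ∷ xs) with P? x
... | no  _ = cong suc (length-filter-split P? xs)
... | yes _ = trans (ℕₚ.+-suc _ _) (cong suc (length-filter-split P? xs))

cartesianProduct-map : ∀ (f : X → Y) xs ys →
  cartesianProduct (map f xs) (map f ys) ≡ map (λ (x , y) → f x , f y) (cartesianProduct xs ys)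
cartesianProduct-map f []       ys = refl
cartesianProduct-map f (x ∷ xs) ys = trans
  (cong₂ _++_ (trans (sym (map-∘ ys)) (map-∘ ys)) (cartesianProduct-map f xs ys))
  (sym (map-++ _ (map (x ,_) ys) (cartesianProduct xs ys)))

take-∈ : ∀ {X : Set} n {xs : List X} {x} → x ∈ take n xs → x ∈ xs
take-∈ (suc n) {_ ∷ _} (here eq)  = here eq
take-∈ (suc n) {_ ∷ _} (there x∈) = there (take-∈ n x∈)

*-self-cancel-≤ : ∀ {m n} → m * m ≤ n * n → m ≤ n
*-self-cancel-≤ le = ℕₚ.≮⇒≥ λ lt → ℕₚ.<⇒≱ (ℕₚ.*-mono-< lt lt) le

floor-sqrt : ∀ n → ∃ λ m → m * m ≤ n × n < suc m * suc m
floor-sqrt zero = 0 , z≤n , s≤s z≤n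
floor-sqrt (suc n) with floor-sqrt n
... | m , le , lt with suc m * suc m ℕ.≤? suc n
...   | yes le′ = suc m , le′ , ℕₚ.≤-<-trans lt (ℕₚ.*-mono-< (ℕₚ.n<1+n (suc m)) (ℕₚ.n<1+n (suc m)))
...   | no ¬le  = m , ℕₚ.m≤n⇒m≤1+n le , ℕₚ.≰⇒> ¬le

^-cancelʳ-≤ : ∀ n .{{_ : ℕ.NonZero n}} {x y} → x ^ n ≤ y ^ n → x ≤ y
^-cancelʳ-≤ n le = ℕₚ.≮⇒≥ λ lt → ℕₚ.<⇒≱ (ℕₚ.^-monoˡ-< n lt) le

-- Compares rational exponents within ℕ: raise the hypothesis to the power a, enlarge the exponent
-- of y, which is allowed as y ≥ 1, and take c-th roots.
^-exponent-≤ : ∀ {x y a b c d} .{{_ : ℕ.NonZero c}} .{{_ : ℕ.NonZero y}} →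
  x ^ c ≤ y ^ d → d * a ≤ b * c → x ^ a ≤ y ^ b
^-exponent-≤ {x} {y} {a} {b} {c} {d} le le′ = ^-cancelʳ-≤ c (begin
  (x ^ a) ^ c  ≡⟨ ℕₚ.^-*-assoc x a c ⟩
  x ^ (a * c)  ≡⟨ cong (x ^_) (ℕₚ.*-comm a c) ⟩
  x ^ (c * a)  ≡⟨ ℕₚ.^-*-assoc x c a ⟨
  (x ^ c) ^ a  ≤⟨ ℕₚ.^-monoˡ-≤ a le ⟩
  (y ^ d) ^ a  ≡⟨ ℕₚ.^-*-assoc y d a ⟩
  y ^ (d * a)  ≤⟨ ℕₚ.^-monoʳ-≤ y le′ ⟩
  y ^ (b * c)  ≡⟨ ℕₚ.^-*-assoc y b c ⟨
  (y ^ b) ^ c  ∎)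
  where open ℕₚ.≤-Reasoning

^-distribʳ-* : ∀ n x y → (x * y) ^ n ≡ x ^ n * y ^ n
^-distribʳ-* zero    x y = refl
^-distribʳ-* (suc n) x y = trans (cong (x * y *_) (^-distribʳ-* n x y)) (alg x y (x ^ n) (y ^ n))
  where alg : ∀ a b c d → a * b * (c * d) ≡ a * c * (b * d)
        alg = ℕR.solve-∀

∈⇒0<length : ∀ {X : Set} {x : X} {xs} → x ∈ xs → 0 < length xs
∈⇒0<length (here _)  = s≤s z≤n
∈⇒0<length (there _) = s≤s z≤n

0<length⇒∈ : ∀ {X : Set} {xs : List X} → 0 < length xs → ∃ λ x → x ∈ xs
0<length⇒∈ {xs = x ∷ _} _ = x , here refl

-- Arithmetic modulo a prime and Fermat's little theorem

module _ {p : ℕ} (pr : Prime p) where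

  private instance
    p≢0 = prime⇒nonZero pr

  prime⇒1<p : 1 < p
  prime⇒1<p = ℕ.nonTrivial⇒n>1 p {{prime⇒nonTrivial pr}}

  p∤small! : ∀ k → k < p → ¬ p ℕ∣.∣ k !
  p∤small! zero    _   p∣1 = ℕₚ.<⇒≱ prime⇒1<p (ℕ∣.∣⇒≤ p∣1)
  p∤small! (suc k) k<p p∣  with euclidsLemma (suc k) (k !) pr p∣
  ... | inj₁ d = ℕₚ.<⇒≱ k<p (ℕ∣.∣⇒≤ d)
  ... | inj₂ d = p∤small! k (ℕₚ.<-trans (ℕₚ.n<1+n k) k<p) d

  -- The prime p divides p!, which is the binomial coefficient times k! (p - k)!, and it divides
  -- neither of these two factorials.
  p∣pCk : ∀ k → 0 < k → k < p → p ℕ∣.∣ p C k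
  p∣pCk k 0<k k<p with euclidsLemma (p C k) (k ! * (p ∸ k) !) pr
                        (subst (p ℕ∣.∣_) (sym eq) (n∣n! p))
    where
    instance _ = k ℕₚ.!* (p ∸ k) !≢0
    eq : (p C k) * (k ! * (p ∸ k) !) ≡ p !
    eq = trans (cong (_* (k ! * (p ∸ k) !)) (nCk≡n!/k![n-k]! (ℕₚ.<⇒≤ k<p)))
               (m/n*n≡m (k![n∸k]!∣n! (ℕₚ.<⇒≤ k<p)))
  ... | inj₁ d = d
  ... | inj₂ d with euclidsLemma (k !) ((p ∸ k) !) pr d
  ...   | inj₁ e = contradiction e (p∤small! k k<p)
  ...   | inj₂ e = contradiction e (p∤small! (p ∸ k) (ℕₚ.∸-monoʳ-< 0<k (ℕₚ.<⇒≤ k<p)))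

  -- The induction step of Fermat's theorem; s collects the middle terms of the binomial expansion.
  [1+x]^p : ∀ x → ∃ λ s → p ℕ∣.∣ s × (x + 1) ^ p ≡ 1 + (s + x ^ p)
  [1+x]^p x = go p refl
    where
    go : ∀ n → p ≡ n → ∃ λ s → p ℕ∣.∣ s × (x + 1) ^ p ≡ 1 + (s + x ^ p)
    go zero    refl = contradiction prime⇒1<p λ ()
    go (suc q) refl = Sum.sum middle , ∣-sum middle divisible , (begin
      (x + 1) ^ p                                  ≡⟨ Exp≡^ (x + 1) p ⟨
      (x + 1) Exp.^ p                              ≡⟨ Binomial.theorem p x 1 ⟩
      t Fin.zero + Sum.sum (t ∘ Fin.suc)           ≡⟨ cong (t Fin.zero ℕ.+_) (Sum.sum-init-last (t ∘ Fin.suc)) ⟩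
      t Fin.zero + (Sum.sum middle + t (fromℕ p))  ≡⟨ cong₂ (λ a b → a + (Sum.sum middle + b)) first last ⟩
      1 + (Sum.sum middle + x ^ p)                 ∎)
      where
      open ≡-Reasoning
      t : Fin (suc p) → ℕ
      t = Binomial.binomialTerm x 1 p
      middle : Fin q → ℕ
      middle i = t (Fin.suc (inject₁ i))
      1^ : ∀ n → 1 Exp.^ n ≡ 1
      1^ zero    = refl
      1^ (suc n) = trans (ℕₚ.*-identityˡ _) (1^ n)
      first : t Fin.zero ≡ 1
      first = trans (×≡* 1 _) (trans (ℕₚ.*-identityˡ _) (trans (ℕₚ.*-identityˡ _) (1^ p)))
      last : t (fromℕ p) ≡ x ^ p
      last = begin
        t (fromℕ p)                                        ≡⟨ ×≡* (p C toℕ (fromℕ p)) _ ⟩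
        (p C toℕ (fromℕ p)) * (x Exp.^ toℕ (fromℕ p) * 1 Exp.^ (p ∸ toℕ (fromℕ p)))
          ≡⟨ cong (λ k → (p C k) * (x Exp.^ k * 1 Exp.^ (p ∸ k))) (toℕ-fromℕ p) ⟩
        (p C p) * (x Exp.^ p * 1 Exp.^ (p ∸ p))
          ≡⟨ cong₂ _*_ (nCn≡1 p) (cong₂ _*_ (Exp≡^ x p) (1^ (p ∸ p))) ⟩
        1 * (x ^ p * 1)                                    ≡⟨ ℕₚ.*-identityˡ _ ⟩
        x ^ p * 1                                          ≡⟨ ℕₚ.*-identityʳ _ ⟩
        x ^ p                                              ∎
      divisible : ∀ i → p ℕ∣.∣ middle i
      divisible i = subst (p ℕ∣.∣_) (sym (×≡* (p C toℕ (Fin.suc (inject₁ i))) _))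
        (ℕ∣.∣m⇒∣m*n _ (p∣pCk _ (s≤s z≤n)
          (s≤s (subst (_< q) (sym (toℕ-inject₁ i)) (toℕ<n i)))))

  infix 4 _≋_
  -- A record rather than bare divisibility of the difference, so that x and y can be inferred from
  -- the type.
  record _≋_ (x y : ℤ) : Set where
    constructor mod-≋
    field ≋⇒∣ : + p ∣ x ⊝ y
  open _≋_ public

  ≋-reflexive : ∀ {x y} → x ≡ y → x ≋ y
  ≋-reflexive {x} refl = mod-≋ (divides 0ℤ (ℤₚ.i≡j⇒i-j≡0 {x} refl))

  ≋-sym : ∀ {x y} → x ≋ y → y ≋ x
  ≋-sym {x} {y} (mod-≋ d) = mod-≋ (subst (+ p ∣_) (neg x y) (∣m⇒∣-m d))
    where neg : ∀ x y → - (x ⊝ y) ≡ y ⊝ x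
          neg = solve-∀

  ≋-trans : ∀ {x y z} → x ≋ y → y ≋ z → x ≋ z
  ≋-trans {x} {y} {z} (mod-≋ d) (mod-≋ e) = mod-≋ (subst (+ p ∣_) (eq x y z) (∣m∣n⇒∣m+n d e))
    where eq : ∀ x y z → (x ⊝ y) ⊕ (y ⊝ z) ≡ x ⊝ z
          eq = solve-∀

  ⊗-cong : ∀ {x y u v} → x ≋ y → u ≋ v → x ⊗ u ≋ y ⊗ v
  ⊗-cong {x} {y} {u} {v} (mod-≋ d) (mod-≋ e) =
    mod-≋ (subst (+ p ∣_) (eq x y u v) (∣m∣n⇒∣m+n (∣m⇒∣m*n u d) (∣n⇒∣m*n y e)))
    where eq : ∀ x y u v → (x ⊝ y) ⊗ u ⊕ y ⊗ (u ⊝ v) ≡ x ⊗ u ⊝ y ⊗ v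
          eq = solve-∀

  ⋆-cong : ∀ {x y} n → x ≋ y → x ⋆ n ≋ y ⋆ n
  ⋆-cong zero    d = ≋-reflexive refl
  ⋆-cong (suc n) d = ⊗-cong d (⋆-cong n d)

  fermatℕ : ∀ x → + (x ^ p) ≋ + x
  fermatℕ zero    = ≋-reflexive (cong +_ (zero^ p prime⇒1<p))
    where zero^ : ∀ n → 1 < n → 0 ^ n ≡ 0
          zero^ (suc n) _ = refl
  fermatℕ (suc x) with [1+x]^p x
  ... | s , p∣s , eq = mod-≋ (subst (+ p ∣_) (sym eq′)
    (∣m∣n⇒∣m+n (∣ᵤ⇒∣ {+ p} {+ s} p∣s) (≋⇒∣ (fermatℕ x))))
    where
    rearrange : ∀ s y x → (1ℤ ⊕ (s ⊕ y)) ⊝ (1ℤ ⊕ x) ≡ s ⊕ (y ⊝ x)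
    rearrange = solve-∀
    eq′ : + (suc x ^ p) ⊝ + suc x ≡ + s ⊕ (+ (x ^ p) ⊝ + x)
    eq′ = trans (cong (λ z → + z ⊝ + suc x) (trans (cong (_^ p) (ℕₚ.+-comm 1 x)) eq))
                (rearrange (+ s) (+ (x ^ p)) (+ x))

  fermat : ∀ x → x ⋆ p ≋ x
  -- The induction covers natural numbers only, so x is first replaced by its residue.
  fermat x = ≋-trans (⋆-cong p x≋r)
    (≋-trans (≋-reflexive (⋆-pos r p)) (≋-trans (fermatℕ r) (≋-sym x≋r)))
    where
    r = x ℤ.%ℕ p
    cancel : ∀ r q → (r ⊕ q) ⊝ r ≡ q
    cancel = solve-∀
    x≋r : x ≋ + r
    x≋r = mod-≋ (divides (x ℤ./ℕ p)
      (trans (cong (_⊝ + r) (a≡a%ℕn+[a/ℕn]*n x p)) (cancel (+ r) (x ℤ./ℕ p ⊗ + p))))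

  ∣-prime : ∀ x y → + p ∣ x ⊗ y → + p ∣ x ⊎ + p ∣ y
  ∣-prime x y d with euclidsLemma ℤ.∣ x ∣ ℤ.∣ y ∣ pr (subst (p ℕ∣.∣_) (ℤₚ.abs-* x y) (∣⇒∣ᵤ d))
  ... | inj₁ e = inj₁ (∣ᵤ⇒∣ e)
  ... | inj₂ e = inj₂ (∣ᵤ⇒∣ e)

  ∣-cancel : ∀ {x y} → ¬ + p ∣ x → + p ∣ x ⊗ y → + p ∣ y
  ∣-cancel {x} {y} ¬d d with ∣-prime x y d
  ... | inj₁ e = contradiction e ¬d
  ... | inj₂ e = e

  -- Power series modulo p and lacunary products

  ∣-B : ∀ u {s} → (∀ j → + p ∣ s j) → ∀ j → + p ∣ B u s j
  ∣-B u d zero    = ∣m∣n⇒∣m-n (d 0) (∣n⇒∣m*n u (divides 0ℤ refl))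
  ∣-B u d (suc j) = ∣m∣n⇒∣m-n (d (suc j)) (∣n⇒∣m*n u (d j))

  ∣-Bs-pow : ∀ us k {s} → (∀ j → + p ∣ s j) → ∀ j → + p ∣ Bs-pow us k s j
  ∣-Bs-pow us zero    d = d
  ∣-Bs-pow us (suc k) d = go us
    where
    go : ∀ vs j → + p ∣ Bs vs (Bs-pow us k _) j
    go []       = ∣-Bs-pow us k d
    go (v ∷ vs) = ∣-B v (go vs)

  -- Zero modulo p and T^l; it concerns low coefficients, as `Below` concerns high ones.
  Vanishes : ℕ → Seq → Set
  Vanishes l s = ∀ j → j < l → + p ∣ s j

  -- The factor 1 - u T has constant term 1, so it can be divided out coefficient by coefficient
  -- from the bottom.
  B-vanishes⁻ : ∀ u {l s} → Vanishes l (B u s) → Vanishes l s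
  B-vanishes⁻ u {s = s} d zero    lt = subst (+ p ∣_) (alg u (s 0)) (d 0 lt)
    where alg : ∀ u x → x ⊝ u ⊗ 0ℤ ≡ x
          alg = solve-∀
  B-vanishes⁻ u {s = s} d (suc j) lt = subst (+ p ∣_) (alg (s (suc j)) (u ⊗ s j))
    (∣m∣n⇒∣m+n (d (suc j) lt) (∣n⇒∣m*n u (B-vanishes⁻ u {s = s} d j (ℕₚ.<-trans (ℕₚ.n<1+n j) lt))))
    where alg : ∀ x y → (x ⊝ y) ⊕ y ≡ x
          alg = solve-∀

  Bs-vanishes⁻ : ∀ us {l s} → Vanishes l (Bs us s) → Vanishes l s
  Bs-vanishes⁻ []       d = d
  Bs-vanishes⁻ (u ∷ us) d = Bs-vanishes⁻ us (B-vanishes⁻ u d)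

  Bs-pow-vanishes⁻ : ∀ us k {l s} → Vanishes l (Bs-pow us k s) → Vanishes l s
  Bs-pow-vanishes⁻ us zero    d = d
  Bs-pow-vanishes⁻ us (suc k) d = Bs-pow-vanishes⁻ us k (Bs-vanishes⁻ us d)

  -- If (1 - u T) s ≡ 1 + c T^p, then s_j ≡ u^j for all j < p. Since s has degree below p, its last
  -- coefficient gives c = - u s_(p-1) ≡ - u^p.
  root-of-binomial : ∀ {u s} → (∀ j → p ≤ j → s j ≡ 0ℤ) →
    + p ∣ B u s 0 ⊝ 1ℤ → (∀ j → 0 < j → j < p → + p ∣ B u s j) → + p ∣ B u s p ⊕ u ⋆ p
  root-of-binomial {u} {s} below d₀ dⱼ = last p refl
    where
    powers : ∀ j → j < p → + p ∣ s j ⊝ u ⋆ j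
    powers zero    lt = subst (+ p ∣_) (alg u (s 0)) d₀
      where alg : ∀ u x → (x ⊝ u ⊗ 0ℤ) ⊝ 1ℤ ≡ x ⊝ 1ℤ
            alg = solve-∀
    powers (suc j) lt = subst (+ p ∣_) (alg u (s (suc j)) (s j) (u ⋆ j))
      (∣m∣n⇒∣m+n (dⱼ (suc j) (s≤s z≤n) lt) (∣n⇒∣m*n u (powers j (ℕₚ.<-trans (ℕₚ.n<1+n j) lt))))
      where alg : ∀ u x y z → (x ⊝ u ⊗ y) ⊕ u ⊗ (y ⊝ z) ≡ x ⊝ u ⊗ z
            alg = solve-∀
    last : ∀ n → p ≡ n → + p ∣ B u s n ⊕ u ⋆ n
    last zero    eq = contradiction (subst (1 <_) eq prime⇒1<p) λ ()
    last (suc q) eq = subst (+ p ∣_)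
      (sym (trans (cong (λ x → (x ⊝ u ⊗ s q) ⊕ u ⊗ u ⋆ q) (below (suc q) (ℕₚ.≤-reflexive eq)))
                  (alg u (s q) (u ⋆ q))))
      (∣m⇒∣-m (∣n⇒∣m*n u (powers q (ℕₚ.≤-reflexive (sym eq)))))
      where alg : ∀ u y z → (0ℤ ⊝ u ⊗ y) ⊕ u ⊗ z ≡ - (u ⊗ (y ⊝ z))
            alg = solve-∀

  p∤small : ∀ j → 0 < j → j < p → ¬ + p ∣ + j
  p∤small (suc j) _ lt d = ℕₚ.<⇒≱ lt (ℕ∣.∣⇒≤ (∣⇒∣ᵤ d))

  -- The product G is 1 + O(T^l) modulo p and has degree at most p. Once θ G ≡ 0 is known, G ≡ 1 + c
  -- T^p, and every u in `us` satisfies u ≡ u^p ≡ - c.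
  lacunary-collapse : ∀ {us k f d l} → Below d f →
    length us + d ≤ l → suc k * length us + d ≤ suc p → 0 < l →
    (∀ j → j < l → + p ∣ Bs-pow us (suc k) f j ⊝ δ j) →
    ∀ {u v} → u ∈ us → v ∈ us → + p ∣ u ⊝ v
  lacunary-collapse {us} {k} {f} {d} {l} below-f len≤l len≤p 0<l G≡δ {u} {v} u∈ v∈ =
    ≋⇒∣ (≋-trans (≋-sym (fermat u)) (≋-trans uᵖ≋vᵖ (fermat v)))
    where
    G = Bs-pow us (suc k) f
    P = Bs-pow us k f

    θG≡0 : ∀ j → + p ∣ θ G j
    θG≡0 with θ-Bs-pow us k f below-f
    ... | r , below-r , eq = λ j → subst (+ p ∣_) (sym (eq j)) (∣-Bs-pow us k r≡0 j)
      where
      low : Vanishes l (θ G)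
      low zero    lt = divides 0ℤ refl
      low (suc j) lt = ∣n⇒∣m*n (+ suc j) (subst (+ p ∣_) (alg (G (suc j))) (G≡δ (suc j) lt))
        where alg : ∀ x → x ⊝ 0ℤ ≡ x
              alg = solve-∀
      -- Below l, r vanishes modulo p because θ G does and the factors can be divided out; from l on
      -- it vanishes by its degree. Thus lacunarity beats the degree of r.
      r≡0 : ∀ j → + p ∣ r j
      r≡0 j with j ℕₚ.<? l
      ... | yes lt = Bs-pow-vanishes⁻ us k (λ i lt′ → subst (+ p ∣_) (eq i) (low i lt′)) j lt
      ... | no ¬lt = divides 0ℤ (below-r j (ℕₚ.≤-trans len≤l (ℕₚ.≮⇒≥ ¬lt)))

    -- The coefficient of θ G is j times that of G, and j is invertible modulo p in this range.
    G≡0 : ∀ j → 0 < j → j < p → + p ∣ G j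
    G≡0 j 0<j j<p = ∣-cancel (p∤small j 0<j j<p) (θG≡0 j)

    root : ∀ {w} → w ∈ us → + p ∣ G p ⊕ w ⋆ p
    root {w} w∈ with factor-out w∈ (Bs-pow-below us k below-f)
    ... | s , eq , below-s = subst (λ x → + p ∣ x ⊕ w ⋆ p) (sym (eq p))
      (root-of-binomial (λ j p≤j → below-s j (ℕₚ.≤-trans
          (subst (_≤ suc p) (ℕₚ.+-assoc (length us) (k * length us) d) len≤p) (s≤s p≤j)))
        (subst (λ x → + p ∣ x ⊝ 1ℤ) (eq 0) (G≡δ 0 0<l))
        (λ j 0<j j<p → subst (+ p ∣_) (eq j) (G≡0 j 0<j j<p)))

    uᵖ≋vᵖ : u ⋆ p ≋ v ⋆ p
    uᵖ≋vᵖ = mod-≋ (subst (+ p ∣_) (alg (G p) (u ⋆ p) (v ⋆ p)) (∣m∣n⇒∣m-n (root u∈) (root v∈)))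
      where alg : ∀ g x y → (g ⊕ x) ⊝ (g ⊕ y) ≡ x ⊝ y
            alg = solve-∀

  -- Roots modulo p and the vanishing of complete homogeneous polynomials

  Distinct : List ℤ → Set
  Distinct = AllPairs (λ x y → ¬ + p ∣ x ⊝ y)

  -- Lagrange's root count: split off one root r; the other roots differ from r modulo p, hence are
  -- roots of the quotient, whose degree bound is one less.
  poly-roots : ∀ {d φ ys} → Polynomial d φ → Distinct ys → d < length ys →
    All (λ y → + p ∣ φ y) ys → ∀ y → + p ∣ φ y
  poly-roots {φ = φ} {r ∷ ys} (constant c e) _ _ (d ∷ _) y =
    subst (+ p ∣_) (trans (e r) (sym (e y))) d
  poly-roots {suc d} {φ} {r ∷ ys} P@(horner _ _ _) (r≢ys ∷ dys) (s≤s lt) (p∣φr ∷ p∣φys) y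
    with poly-factor r P
  ... | χ , Q , e = subst (+ p ∣_) (sym (e y)) (∣m∣n⇒∣m+n p∣φr (∣n⇒∣m*n (y ⊝ r) (p∣χ y)))
    where
    alg : ∀ a x → (a ⊕ x) ⊝ a ≡ x
    alg = solve-∀
    neg : ∀ y → - (y ⊝ r) ≡ r ⊝ y
    neg y = alg′ y r
      where alg′ : ∀ y r → - (y ⊝ r) ≡ r ⊝ y
            alg′ = solve-∀
    rootχ : ∀ {y} → ¬ + p ∣ r ⊝ y → + p ∣ φ y → + p ∣ χ y
    rootχ {y} r≢y p∣φy = ∣-cancel (λ d → r≢y (subst (+ p ∣_) (neg y) (∣m⇒∣-m d)))
      (subst (+ p ∣_) (trans (cong (_⊝ φ r) (e y)) (alg (φ r) ((y ⊝ r) ⊗ χ y))) (∣m∣n⇒∣m-n p∣φy p∣φr))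
    p∣χ : ∀ y → + p ∣ χ y
    p∣χ = poly-roots Q dys lt (All.zipWith (λ (r≢y , p∣φy) → rootχ r≢y p∣φy) (r≢ys , p∣φys))

  -- A divided difference depends only on the function x ↦ x^j on F_p, and x^(j+p−1) = x^j for j ≥ 1.
  H-periodic : ∀ q → p ≡ suc q → ∀ u us → Distinct (u ∷ us) → ∀ j →
    + p ∣ H (u ∷ us) (2 + (j + q)) ⊝ H (u ∷ us) (2 + j)
  H-periodic q refl u [] _ j = subst (+ p ∣_) eq
    (∣n⇒∣m*n (u ⋆ j) (≋⇒∣ (fermat u)))
    where
    alg : ∀ u x y → x ⊗ (u ⊗ y ⊝ u) ≡ u ⊗ (x ⊗ y) ⊝ u ⊗ x
    alg = solve-∀
    eq : u ⋆ j ⊗ (u ⋆ suc q ⊝ u) ≡ I u δ (suc (j + q)) ⊝ I u δ (suc j)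
    eq = trans (alg u (u ⋆ j) (u ⋆ q))
      (sym (cong₂ _⊝_ (trans (I-δ u (suc (j + q))) (cong (u ⊗_) (ℤₚ.^-distribˡ-+-* u j q))) (I-δ u (suc j))))
  H-periodic q refl u (v ∷ us) ((u≢v ∷ u≢us) ∷ (v≢us ∷ dus)) j =
    ∣-cancel u≢v (subst (+ p ∣_) (sym eq)
      (∣m∣n⇒∣m-n (H-periodic q refl u us (u≢us ∷ dus) j) (H-periodic q refl v us (v≢us ∷ dus) j)))
    where
    s = H us
    dd : ∀ i → (u ⊝ v) ⊗ H (u ∷ v ∷ us) (2 + i) ≡ I u s (suc i) ⊝ I v s (suc i)
    dd i = trans (cong ((u ⊝ v) ⊗_) (I-shift u (I v s) (suc i))) (sym (I-divided-difference u v s i))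
    alg₁ : ∀ w x y → w ⊗ (x ⊝ y) ≡ w ⊗ x ⊝ w ⊗ y
    alg₁ = solve-∀
    alg₂ : ∀ a b c d → (a ⊝ b) ⊝ (c ⊝ d) ≡ (a ⊝ c) ⊝ (b ⊝ d)
    alg₂ = solve-∀
    g₁ = H (u ∷ v ∷ us) (2 + (j + q))
    g₀ = H (u ∷ v ∷ us) (2 + j)
    eq : (u ⊝ v) ⊗ (g₁ ⊝ g₀)
       ≡ (I u s (suc (j + q)) ⊝ I u s (suc j)) ⊝ (I v s (suc (j + q)) ⊝ I v s (suc j))
    eq = trans (alg₁ (u ⊝ v) g₁ g₀) (trans (cong₂ _⊝_ (dd (j + q)) (dd j))
      (alg₂ (I u s (suc (j + q))) (I v s (suc (j + q))) (I u s (suc j)) (I v s (suc j))))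

  -- With n nodes, h_j is entry n + j of `H`. One period p - 1 lower the index is less than n, where
  -- Tⁿ h has no terms.
  h-vanishes : ∀ {us} → Distinct us → ∀ {j} → p < length us + j → suc j < p → + p ∣ h us j
  h-vanishes {[]} _ lt lt′ = contradiction (ℕₚ.<-trans lt (ℕₚ.<-trans (ℕₚ.n<1+n _) lt′)) (ℕₚ.<-irrefl refl)
  h-vanishes {us@(u ∷ us′)} dus {j} lt lt′ = go p refl lt lt′
    where
    n = length us
    go : ∀ p′ → p ≡ p′ → p′ < n + j → suc j < p′ → + p ∣ h us j
    go (suc q) eq lt (s≤s j<q) = subst (+ p ∣_) eq′
      (∣m∣n⇒∣m+n (H-periodic q eq u us′ dus i) (subst (+ p ∣_) (sym H≡0) (divides 0ℤ refl)))
      where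
      -- The bound p < n + j keeps the reduced index 2 + i at least 2, where periodicity applies; j
      -- < p - 1 brings it below n.
      i = (n + j) ∸ (2 + q)
      n+j≡ : 2 + (i + q) ≡ n + j
      n+j≡ = trans (cong suc (trans (ℕₚ.+-comm 1 (i + q)) (ℕₚ.+-assoc i q 1)))
               (trans (trans (sym (ℕₚ.+-suc i (q + 1))) (cong (λ x → i + suc x) (ℕₚ.+-comm q 1))) (ℕₚ.m∸n+n≡m lt))
      2+i<n : 2 + i < n
      2+i<n = ℕₚ.+-cancelʳ-< q (2 + i) n (subst (_< n + q) (sym n+j≡) (ℕₚ.+-monoʳ-< n j<q))
      H≡0 : H us (2 + i) ≡ 0ℤ
      H≡0 = trans (H≗shifts-h us (2 + i)) (shifts-< n (h us) (2 + i) 2+i<n)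
      alg : ∀ x y → (x ⊝ y) ⊕ y ≡ x
      alg = solve-∀
      eq′ : (H us (2 + (i + q)) ⊝ H us (2 + i)) ⊕ H us (2 + i) ≡ h us j
      eq′ = trans (alg (H us (2 + (i + q))) (H us (2 + i)))
        (trans (cong (H us) n+j≡) (trans (H≗shifts-h us (n + j)) (shifts-+ n (h us) j)))

  Bs-vanishes : ∀ us {l s} → Vanishes l s → Vanishes l (Bs us s)
  Bs-vanishes []       d = d
  Bs-vanishes (u ∷ us) {s = s} d zero lt =
    ∣m∣n⇒∣m-n (Bs-vanishes us {s = s} d zero lt) (∣n⇒∣m*n u (divides 0ℤ refl))
  Bs-vanishes (u ∷ us) {s = s} d (suc j) lt =
    ∣m∣n⇒∣m-n (Bs-vanishes us {s = s} d (suc j) lt)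
      (∣n⇒∣m*n u (Bs-vanishes us {s = s} d j (ℕₚ.<-trans (ℕₚ.n<1+n j) lt)))

  -- Rédei polynomials and the number of generic slopes

  module _ {as : List ℤ} {k : ℕ} (#as : length as ≡ suc k) (n≤p : suc k * suc k ≤ p)
           {ys : List ℤ} (dys : Distinct ys) (generic : All (λ y → Distinct (intercepts as y)) ys)
           (l : ℕ) (l≤#ys : l ≤ length ys) (l<p : l < p) where

    private
      n = suc k * suc k
      us = intercepts as

    length-intercepts : ∀ y → length (us y) ≡ n
    length-intercepts y = trans (length-map _ (cartesianProduct as as))
      (trans (length-cartesianProduct as as) (cong₂ _*_ #as #as))

    -- As a function of y this is a polynomial of degree at most j with more than j roots, namely
    -- the generic slopes; hence it also vanishes at y = 0.
    h-intercepts-vanishes : ∀ j → p < n + j → j < l → ∀ y → + p ∣ h (us y) j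
    h-intercepts-vanishes j lt j<l = poly-roots (h-polynomial (cartesianProduct as as) j) dys
      (ℕₚ.<-≤-trans j<l l≤#ys)
      (All.map (λ {y} d → h-vanishes d (subst (λ x → p < x + j) (sym (length-intercepts y)) lt) (ℕₚ.≤-<-trans j<l l<p)) generic)

    -- The inverse series cut at degree p - n, so that its product with the n linear factors has
    -- degree at most p. The correction `tail` is minus the part cut off.
    quotient : Seq
    quotient j with n + j ℕ.≤? p
    ... | yes _ = h (us 0ℤ) j
    ... | no  _ = 0ℤ

    tail : Seq
    tail j with n + j ℕ.≤? p
    ... | yes _ = 0ℤ
    ... | no  _ = - h (us 0ℤ) j

    quotient≗ : quotient ≗ h (us 0ℤ) ⊞ tail
    quotient≗ j with n + j ℕ.≤? p
    ... | yes _ = sym (ℤₚ.+-identityʳ _)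
    ... | no  _ = sym (ℤₚ.+-inverseʳ (h (us 0ℤ) j))

    tail-vanishes : Vanishes l tail
    tail-vanishes j lt with n + j ℕ.≤? p
    ... | yes _  = divides 0ℤ refl
    ... | no ¬le = ∣m⇒∣-m (h-intercepts-vanishes j (ℕₚ.≰⇒> ¬le) lt 0ℤ)

    quotient-below : Below (suc (p ∸ n)) quotient
    quotient-below j le with n + j ℕ.≤? p
    ... | yes le′ = contradiction (ℕₚ.≤-trans le (ℕₚ.m+n≤o⇒m≤o∸n j (subst (_≤ p) (ℕₚ.+-comm n j) le′))) ℕₚ.1+n≰n
    ... | no  _  = refl

    product≡δ : ∀ j → j < l → + p ∣ Bs-pow as (suc k) quotient j ⊝ δ j
    product≡δ j lt = subst (+ p ∣_) (sym eq) (Bs-vanishes (us 0ℤ) tail-vanishes j lt)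
      where
      open ≡-Reasoning
      alg : ∀ x y → (x ⊕ y) ⊝ x ≡ y
      alg = solve-∀
      eq : Bs-pow as (suc k) quotient j ⊝ δ j ≡ Bs (us 0ℤ) tail j
      eq = begin
        Bs-pow as (suc k) quotient j ⊝ δ j       ≡⟨ cong (λ i → Bs-pow as i quotient j ⊝ δ j) #as ⟨
        Bs-pow as (length as) quotient j ⊝ δ j   ≡⟨ cong (λ s → s j ⊝ δ j) (Bs-intercepts-0 as as quotient) ⟨
        Bs (us 0ℤ) quotient j ⊝ δ j              ≡⟨ cong (_⊝ δ j) (Bs-cong (us 0ℤ) quotient≗ j) ⟩
        Bs (us 0ℤ) (h (us 0ℤ) ⊞ tail) j ⊝ δ j    ≡⟨ cong (_⊝ δ j) (Bs-⊞ (us 0ℤ) (h (us 0ℤ)) tail j) ⟩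
        (Bs (us 0ℤ) (h (us 0ℤ)) j ⊕ Bs (us 0ℤ) tail j) ⊝ δ j
          ≡⟨ cong (λ x → (x ⊕ Bs (us 0ℤ) tail j) ⊝ δ j) (Bs-h (us 0ℤ) j) ⟩
        (δ j ⊕ Bs (us 0ℤ) tail j) ⊝ δ j          ≡⟨ alg (δ j) (Bs (us 0ℤ) tail j) ⟩
        Bs (us 0ℤ) tail j                        ∎

    collapse : p < l + suc k * k → ∀ {u v} → u ∈ as → v ∈ as → + p ∣ u ⊝ v
    collapse lt = lacunary-collapse {k = k} quotient-below
      (subst (λ x → x + suc (p ∸ n) ≤ l) (sym #as) len≤l)
      (ℕₚ.≤-reflexive (trans (cong (λ x → suc k * x + suc (p ∸ n)) #as) n+d≡))
      (ℕₚ.≤-trans (s≤s z≤n) len≤l) product≡δ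
      where
      n+d≡ : n + suc (p ∸ n) ≡ suc p
      n+d≡ = trans (ℕₚ.+-suc n (p ∸ n)) (cong suc (ℕₚ.m+[n∸m]≡n n≤p))
      -- Since n = (k + 1) k + (k + 1), the hypothesis on p is this inequality after adding n to
      -- both sides.
      len≤l : suc k + suc (p ∸ n) ≤ l
      len≤l = ℕₚ.+-cancelˡ-≤ n _ _ (begin
        n + (suc k + suc (p ∸ n))    ≡⟨ comm n (suc k) (suc (p ∸ n)) ⟩
        (n + suc (p ∸ n)) + suc k    ≡⟨ cong (_+ suc k) n+d≡ ⟩
        suc p + suc k                ≤⟨ ℕₚ.+-monoˡ-≤ (suc k) lt ⟩
        (l + suc k * k) + suc k      ≡⟨ alg k l ⟩
        n + l                        ∎)
        where
        open ℕₚ.≤-Reasoning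
        comm : ∀ a b c → a + (b + c) ≡ (a + c) + b
        comm = ℕR.solve-∀
        alg : ∀ k l → (l + suc k * k) + suc k ≡ suc k * suc k + l
        alg = ℕR.solve-∀

  generic-slopes-bound : ∀ {as k ys} → length as ≡ suc k → 0 < k → suc k * suc k ≤ p →
    Distinct ys → All (λ y → Distinct (intercepts as y)) ys →
    (∃ λ u → ∃ λ v → u ∈ as × v ∈ as × ¬ + p ∣ u ⊝ v) →
    length ys + suc k * k ≤ p
  generic-slopes-bound {as} {k} {ys} #as 0<k n≤p dys generic (u , v , u∈ , v∈ , u≢v) =
    ℕₚ.≮⇒≥ λ lt → u≢v (go p refl lt u∈ v∈)
    where
    -- Pays for capping l at p - 1: p < (p - 1) + (k + 1) k needs (k + 1) k to be at least 2.
    2≤ : 2 ≤ suc k * k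
    2≤ = ℕₚ.*-mono-≤ (s≤s 0<k) 0<k
    go : ∀ p′ → p ≡ p′ → p′ < length ys + suc k * k → ∀ {u v} → u ∈ as → v ∈ as → + p ∣ u ⊝ v
    go zero    eq _  = contradiction (subst (1 <_) eq prime⇒1<p) λ ()
    go (suc q) eq lt with ℕₚ.≤-total q (length ys)
    ... | inj₁ q≤ = collapse #as n≤p dys generic q q≤ (ℕₚ.≤-reflexive (sym eq))
            (subst (_< q + suc k * k) (sym eq) (subst (_≤ q + suc k * k) (ℕₚ.+-comm q 2) (ℕₚ.+-monoʳ-≤ q 2≤)))
    ... | inj₂ ≤q = collapse #as n≤p dys generic (length ys) ℕₚ.≤-refl (subst (length ys <_) (sym eq) (s≤s ≤q))
            (subst (_< length ys + suc k * k) (sym eq) lt)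

  -- Collisions of points in the plane over F_p

  ∣∣<p⇒≡0 : ∀ m n → m < p → n < p → + p ∣ + m ⊝ + n → m ≡ n
  ∣∣<p⇒≡0 m n m<p n<p d with ∣⇒∣ᵤ d
  ... | e with ℤ.∣ + m ⊝ + n ∣ in eq
  ...   | zero  = ℤₚ.+-injective (ℤₚ.i-j≡0⇒i≡j (+ m) (+ n) (ℤₚ.∣i∣≡0⇒i≡0 eq))
  ...   | suc q = contradiction (ℕ∣.∣⇒≤ e) (ℕₚ.<⇒≱ (subst (_< p) eq small))
    where
    small : ℤ.∣ + m ⊝ + n ∣ < p
    small rewrite ℤₚ.m-n≡m⊖n m n = ℕₚ.≤-<-trans (ℤₚ.∣m⊝n∣≤m⊔n m n) (ℕₚ.⊔-lub m<p n<p)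

  ι-injective : ∀ {x y : Fin p} → + p ∣ ι x ⊝ ι y → x ≡ y
  ι-injective {x} {y} d = toℕ-injective (∣∣<p⇒≡0 (toℕ x) (toℕ y) (toℕ<n x) (toℕ<n y) d)

  modP-≡⇒∣ : ∀ {z w} → modP p pr z ≡ modP p pr w → + p ∣ z ⊝ w
  modP-≡⇒∣ {z} {w} eq = divides (z ℤ./ℕ p ⊝ w ℤ./ℕ p)
    (trans (cong₂ _⊝_ (a≡a%ℕn+[a/ℕn]*n z p) (a≡a%ℕn+[a/ℕn]*n w p))
    (trans (cong (λ r → (+ r ⊕ z ℤ./ℕ p ⊗ + p) ⊝ (+ (w ℤ.%ℕ p) ⊕ w ℤ./ℕ p ⊗ + p)) eq)
           (alg (+ (w ℤ.%ℕ p)) (z ℤ./ℕ p) (w ℤ./ℕ p) (+ p))))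
    where alg : ∀ r a b q → (r ⊕ a ⊗ q) ⊝ (r ⊕ b ⊗ q) ≡ (a ⊝ b) ⊗ q
          alg = solve-∀

  Point : Set
  Point = Fin p × Fin p

  intercept : Fin p → Point → ℤ
  intercept y (a , b) = ι b ⊝ ι a ⊗ ι y

  Collide : Fin p → Point → Point → Set
  Collide y P Q = + p ∣ intercept y P ⊝ intercept y Q

  collide? : ∀ y P Q → Dec (Collide y P Q)
  collide? y P Q = + p ∣? intercept y P ⊝ intercept y Q

  collide-abscissa : ∀ {y a b c d} → (a , c) ≢ (b , d) → Collide y (a , c) (b , d) → a ≢ b
  collide-abscissa {y} {a} {_} {c} {d} ne col refl = ne (cong (a ,_) (ι-injective (subst (+ p ∣_) (alg (ι c) (ι d) (ι a ⊗ ι y)) col)))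
    where alg : ∀ c d x → (c ⊝ x) ⊝ (d ⊝ x) ≡ c ⊝ d
          alg = solve-∀

  -- Subtracting the two congruences leaves (a - b)(y - y′) ≡ 0, and distinct colliding points have
  -- a ≢ b.
  collide-unique : ∀ {P Q y y′} → P ≢ Q → Collide y P Q → Collide y′ P Q → y ≡ y′
  collide-unique {a , c} {b , d} {y} {y′} ne col col′ = ι-injective (∣-cancel
    (collide-abscissa {y} {a} {b} {c} {d} ne col ∘ ι-injective)
    (subst (+ p ∣_) (alg (ι a) (ι b) (ι c) (ι d) (ι y) (ι y′)) (∣m∣n⇒∣m-n col′ col)))
    where alg : ∀ a b c d y y′ → ((c ⊝ a ⊗ y′) ⊝ (d ⊝ b ⊗ y′)) ⊝ ((c ⊝ a ⊗ y) ⊝ (d ⊝ b ⊗ y)) ≡ (a ⊝ b) ⊗ (y ⊝ y′)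
          alg = solve-∀

  -- A slope c − d = y (a − b) makes this form (a − b) times a line of slope y, up to sign.
  value : (a b c d x₀ : Fin p) → Point → ℤ
  value a b c d x₀ (x , z) = (ι c ⊝ ι d) ⊗ (ι x ⊝ ι x₀) ⊝ (ι a ⊝ ι b) ⊗ (ι z ⊝ ι x₀)

  -- With c - d ≡ (a - b) y, the difference of two values is - (a - b) times the difference of the
  -- intercepts, and a - b can be cancelled.
  value-collide : ∀ {a b c d x₀ y P Q} → (a , c) ≢ (b , d) → Collide y (a , c) (b , d) →
    modP p pr (value a b c d x₀ P) ≡ modP p pr (value a b c d x₀ Q) → Collide y P Q
  value-collide {a} {b} {c} {d} {x₀} {y} {x , z} {x′ , z′} ne col eq = ∣-cancel
    (collide-abscissa {y} {a} {b} {c} {d} ne col ∘ ι-injective)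
    (subst (+ p ∣_) (alg (ι a) (ι b) (ι c) (ι d) (ι x₀) (ι x) (ι z) (ι x′) (ι z′) (ι y))
      (∣m∣n⇒∣m-n (∣m⇒∣m*n (ι x ⊝ ι x′) col) (modP-≡⇒∣ {value a b c d x₀ (x , z)} {value a b c d x₀ (x′ , z′)} eq)))
    where
    alg : ∀ a b c d x₀ x z x′ z′ y →
      ((c ⊝ a ⊗ y) ⊝ (d ⊝ b ⊗ y)) ⊗ (x ⊝ x′)
        ⊝ (((c ⊝ d) ⊗ (x ⊝ x₀) ⊝ (a ⊝ b) ⊗ (z ⊝ x₀)) ⊝ ((c ⊝ d) ⊗ (x′ ⊝ x₀) ⊝ (a ⊝ b) ⊗ (z′ ⊝ x₀)))
      ≡ (a ⊝ b) ⊗ ((z ⊝ x ⊗ y) ⊝ (z′ ⊝ x′ ⊗ y))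
    alg = solve-∀

  -- The lower bound when |A|² ≤ p

  module _ {A : List (Fin p)} (uA : Unique A) {k : ℕ} (#A : length A ≡ suc k)
           (0<k : 0 < k) (n≤p : suc k * suc k ≤ p) where

    private
      points = cartesianProduct A A
      as = map ι A
      #as : length as ≡ suc k
      #as = trans (length-map ι A) #A
      upoints : Unique points
      upoints = Uniqueₚ.cartesianProduct⁺ uA uA

    Generic : Fin p → Set
    Generic y = Distinct (intercepts as (ι y))

    generic? : Decidable Generic
    generic? y = allPairs? (λ u v → ¬? (+ p ∣? u ⊝ v)) (intercepts as (ι y))

    -- The set R of directions of A × A, the vertical one excluded: y is such a direction exactly
    -- when two intercepts coincide.
    slopes : List (Fin p)
    slopes = filter (¬? ∘ generic?) (allFin p)

    slope-witness : ∀ {y} → y ∈ slopes →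
      ∃ λ P → ∃ λ Q → P ∈ points × Q ∈ points × P ≢ Q × Collide y P Q
    slope-witness {y} y∈ with allPairs-dichotomy (collide? y) upoints
    ... | inj₂ w  = w
    ... | inj₁ ap = contradiction generic (proj₂ (∈-filter⁻ (¬? ∘ generic?) {xs = allFin p} y∈))
      where
      generic : Generic y
      generic = subst Distinct
        (trans (map-∘ points) (cong (map (λ (a , b) → b ⊝ a ⊗ ι y)) (sym (cartesianProduct-map ι A A))))
        (AllPairsₚ.map⁺ ap)

    distinct-pair : ∀ {B : List (Fin p)} → Unique B → length B ≡ suc k →
      ∃ λ u → ∃ λ v → u ∈ map ι B × v ∈ map ι B × ¬ + p ∣ u ⊝ v
    distinct-pair {_ ∷ []}    _ eq = contradiction (subst (0 <_) (sym (ℕₚ.suc-injective eq)) 0<k) λ ()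
    distinct-pair {a ∷ b ∷ _} ((a≢b ∷ _) ∷ _) _ =
      ι a , ι b , here refl , there (here refl) , a≢b ∘ ι-injective

    -- Generic elements and slopes partition F_p, so the upper bound on the former becomes a lower
    -- bound on the latter.
    slopes-bound : suc k * k ≤ length slopes
    slopes-bound = ℕₚ.+-cancelʳ-≤ (length ys) _ _ (begin
      suc k * k + length ys                      ≡⟨ ℕₚ.+-comm (suc k * k) (length ys) ⟩
      length ys + suc k * k                      ≡⟨ cong (_+ suc k * k) (length-map ι ys) ⟨
      length (map ι ys) + suc k * k              ≤⟨ generic-slopes-bound #as 0<k n≤p dys gys (distinct-pair uA #A) ⟩
      p                                          ≡⟨ length-tabulate (λ (i : Fin p) → i) ⟨
      length (allFin p)                          ≡⟨ length-filter-split generic? (allFin p) ⟨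
      length slopes + length ys                  ∎)
      where
      open ℕₚ.≤-Reasoning
      ys = filter generic? (allFin p)
      dys : Distinct (map ι ys)
      dys = AllPairsₚ.map⁺ (AllPairs.map (_∘ ι-injective) (Uniqueₚ.filter⁺ generic? (Uniqueₚ.allFin⁺ p)))
      gys : All (λ y → Distinct (intercepts as y)) (map ι ys)
      gys = All-map⁺ (all-filter generic? (allFin p))

    -- If F values occur, each slope sees at least n - F collisions among the n points. Summing over
    -- at least (k + 1) k slopes and comparing with n (n - 1) / 2 pairs bounds n - F.
    image-bound : ∀ {zs : List ℕ} →
      (∀ {a b c d x₀ P} → a ∈ A → b ∈ A → c ∈ A → d ∈ A → x₀ ∈ A → P ∈ points →
        modP p pr (value a b c d x₀ P) ∈ zs) →
      suc k * k ≤ 2 * length zs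
    image-bound {zs} value∈ = ℕₚ.+-cancelʳ-≤ (suc k * suc (suc k)) _ _ (begin
      suc k * k + suc k * suc (suc k)      ≡⟨ alg₃ k ⟩
      2 * n                                ≤⟨ ℕₚ.*-monoʳ-≤ 2 (ℕₚ.m≤n+m∸n n F) ⟩
      2 * (F + (n ∸ F))                    ≡⟨ ℕₚ.*-distribˡ-+ 2 F (n ∸ F) ⟩
      2 * F + 2 * (n ∸ F)                  ≤⟨ ℕₚ.+-monoʳ-≤ (2 * F) deficit ⟩
      2 * F + suc k * suc (suc k)          ∎)
      where
      open ℕₚ.≤-Reasoning
      F = length zs
      n = suc k * suc k
      #points : length points ≡ n
      #points = trans (length-cartesianProduct A A) (cong₂ _*_ #A #A)
      alg₃ : ∀ k → suc k * k + suc k * suc (suc k) ≡ 2 * (suc k * suc k)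
      alg₃ = ℕR.solve-∀
      many-collisions : ∀ {y} → y ∈ slopes → n ∸ F ≤ collisions (collide? y) points
      many-collisions {y} y∈ with slope-witness y∈
      ... | (a , c) , (b , d) , P∈ , Q∈ , ne , col
        with ∈-cartesianProduct⁻ A A P∈ | ∈-cartesianProduct⁻ A A Q∈
      ...   | a∈ , c∈ | b∈ , d∈ = ℕₚ.m≤n+o⇒m∸n≤o n F (subst (_≤ F + collisions (collide? y) points) #points
              -- The base point x₀ may be any element of A; a is at hand.
              (length≤image+collisions (collide? y) (λ P → modP p pr (value a b c d a P))
                (λ {P} {Q} → value-collide {a} {b} {c} {d} {a} {y} {P} {Q} ne col) points
                (value∈ a∈ b∈ c∈ d∈ a∈)))
      total : (n ∸ F) * (suc k * k) ≤ pairs points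
      total = ℕₚ.≤-trans (ℕₚ.*-monoʳ-≤ (n ∸ F) slopes-bound) (ℕₚ.≤-trans (∑-≥ many-collisions)
        (∑-collisions≤pairs collide? (Uniqueₚ.filter⁺ (¬? ∘ generic?) (Uniqueₚ.allFin⁺ p)) upoints
          (λ {P} {Q} {y} {y′} → collide-unique {P} {Q} {y} {y′})))
      -- Here n (n - 1) = (k + 1)² k (k + 2), which contains the factor (k + 1) k cancelled in
      -- `deficit`.
      2pairs : 2 * pairs points ≡ suc k * suc (suc k) * (suc k * k)
      2pairs = ℕₚ.+-cancelʳ-≡ n _ _ (trans
        (subst (λ x → 2 * pairs points + x ≡ x * x) #points (2*pairs points)) (alg k))
        where alg : ∀ k → suc k * suc k * (suc k * suc k) ≡ suc k * suc (suc k) * (suc k * k) + suc k * suc k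
              alg = ℕR.solve-∀
      deficit : 2 * (n ∸ F) ≤ suc k * suc (suc k)
      deficit = ℕₚ.*-cancelʳ-≤ _ _ (suc k * k) {{ℕ.>-nonZero (ℕₚ.*-mono-≤ {1} {suc k} (s≤s z≤n) 0<k)}} (begin
        2 * (n ∸ F) * (suc k * k)                    ≡⟨ ℕₚ.*-assoc 2 (n ∸ F) (suc k * k) ⟩
        2 * ((n ∸ F) * (suc k * k))                  ≤⟨ ℕₚ.*-monoʳ-≤ 2 total ⟩
        2 * pairs points                             ≡⟨ 2pairs ⟩
        suc k * suc (suc k) * (suc k * k)            ∎)

  -- Values of the determinant and the permanent

  -- The one property shared by both sets of values from which growth is derived, so the argument is
  -- carried out once.
  ContainsValues : List (Fin p) → List ℕ → Set
  ContainsValues A zs = ∀ {a b c d x₀ x z} → a ∈ A → b ∈ A → c ∈ A → d ∈ A → x₀ ∈ A → x ∈ A → z ∈ A →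
    modP p pr (value a b c d x₀ (x , z)) ∈ zs

  -- The value is the determinant of X - Y, where X has rows (c, a), (z, x) and Y has rows (d, b),
  -- (x₀, x₀).
  cardF2-values : ∀ A → ContainsValues A _
  cardF2-values A a∈ b∈ c∈ d∈ x₀∈ x∈ z∈ = ∈-deduplicate⁺ ℕ._≟_
    (∈-map⁺ (λ XY → modP p pr (detDiff (proj₁ XY) (proj₂ XY)))
      (∈-cartesianProduct⁺ {xs = M2-of A} {ys = M2-of A} (mat c∈ a∈ z∈ x∈) (mat d∈ b∈ x₀∈ x₀∈)))
    where
    mat : ∀ {a b c d} → a ∈ A → b ∈ A → c ∈ A → d ∈ A → (a , b , c , d) ∈ M2-of A
    mat a∈ b∈ c∈ d∈ = ∈-cartesianProduct⁺ a∈ (∈-cartesianProduct⁺ b∈ (∈-cartesianProduct⁺ c∈ d∈))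

  -- Exchanging a and b between the two matrices changes the sign of a - b, which turns the
  -- determinant into a permanent.
  cardG2-values : ∀ A → ContainsValues A _
  cardG2-values A {a} {b} {c} {d} {x₀} {x} {z} a∈ b∈ c∈ d∈ x₀∈ x∈ z∈ =
    subst (λ v → modP p pr v ∈ _) (alg (ι a) (ι b) (ι c) (ι d) (ι x₀) (ι x) (ι z))
    (∈-deduplicate⁺ ℕ._≟_
    (∈-map⁺ (λ XY → modP p pr (perDiff (proj₁ XY) (proj₂ XY)))
      (∈-cartesianProduct⁺ {xs = M2-of A} {ys = M2-of A} (mat c∈ b∈ z∈ x∈) (mat d∈ a∈ x₀∈ x₀∈))))
    where
    mat : ∀ {a b c d} → a ∈ A → b ∈ A → c ∈ A → d ∈ A → (a , b , c , d) ∈ M2-of A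
    mat a∈ b∈ c∈ d∈ = ∈-cartesianProduct⁺ a∈ (∈-cartesianProduct⁺ b∈ (∈-cartesianProduct⁺ c∈ d∈))
    alg : ∀ a b c d x₀ x z → (c ⊝ d) ⊗ (x ⊝ x₀) ⊕ (b ⊝ a) ⊗ (z ⊝ x₀) ≡ (c ⊝ d) ⊗ (x ⊝ x₀) ⊝ (a ⊝ b) ⊗ (z ⊝ x₀)
    alg = solve-∀

  -- Growth for |A| up to p^(9/16)

  module _ {A : List (Fin p)} (uA : Unique A) {zs : List ℕ} (values : ContainsValues A zs) where

    values-nonempty : 0 < length A → 0 < length zs
    values-nonempty 0<#A with 0<length⇒∈ 0<#A
    ... | _ , a∈ = ∈⇒0<length (values a∈ a∈ a∈ a∈ a∈ a∈ a∈)

    square-bound : ∀ m → 0 < m → m ≤ length A → m * m ≤ p → m * m ≤ 4 * length zs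
    -- A single element determines no slope, so here only nonemptiness of the values is used.
    square-bound (suc zero) _ 1≤#A _ = ℕₚ.≤-trans (values-nonempty 1≤#A) (ℕₚ.m≤n*m _ 4)
    square-bound (suc (suc k)) _ m≤#A m²≤p = begin
      suc (suc k) * suc (suc k)          ≤⟨ ℕₚ.m≤m+n _ (suc (suc k) * k) ⟩
      -- For m = k + 2 this is m² + m (m - 2) = 2 m (m - 1), and m (m - 1) is what `image-bound`
      -- controls.
      suc (suc k) * suc (suc k) + suc (suc k) * k  ≡⟨ alg k ⟩
      2 * (suc (suc k) * suc k)          ≤⟨ ℕₚ.*-monoʳ-≤ 2 (image-bound (Uniqueₚ.take⁺ (suc (suc k)) uA)
                                              (trans (length-take (suc (suc k)) A) (ℕₚ.m≤n⇒m⊓n≡m m≤#A)) (s≤s z≤n) m²≤p values′) ⟩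
      2 * (2 * length zs)                ≡⟨ ℕₚ.*-assoc 2 2 (length zs) ⟨
      4 * length zs                      ∎
      where
      open ℕₚ.≤-Reasoning
      A′ = take (suc (suc k)) A
      alg : ∀ k → suc (suc k) * suc (suc k) + suc (suc k) * k ≡ 2 * (suc (suc k) * suc k)
      alg = ℕR.solve-∀
      values′ : ∀ {a b c d x₀ P} → a ∈ A′ → b ∈ A′ → c ∈ A′ → d ∈ A′ → x₀ ∈ A′ → P ∈ cartesianProduct A′ A′ →
        modP p pr (value a b c d x₀ P) ∈ zs
      values′ {P = x , z} a∈ b∈ c∈ d∈ x₀∈ P∈ with ∈-cartesianProduct⁻ A′ A′ P∈
      ... | x∈ , z∈ = values (t a∈) (t b∈) (t c∈) (t d∈) (t x₀∈) (t x∈) (t z∈)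
        where t : ∀ {x} → x ∈ A′ → x ∈ A
              t = take-∈ (suc (suc k))

    -- The exponent is 7/4 + 1/60 = 53/30, cleared of its denominator.
    growth : length A ^ 16 ≤ p ^ 9 → length A ^ 53 ≤ (16 * length zs) ^ 30
    growth #A^16≤p^9 with length A ℕ.≟ 0
    ... | yes #A≡0 = subst (λ n → n ^ 53 ≤ (16 * length zs) ^ 30) (sym #A≡0) z≤n
    ... | no #A≢0 = bound
      where
      0<#A = ℕₚ.n≢0⇒n>0 #A≢0
      instance
        _ = ℕₚ.m*n≢0 16 (length zs) {{_}} {{ℕ.>-nonZero (values-nonempty 0<#A)}}
      4≤16 : 4 * length zs ≤ 16 * length zs
      4≤16 = ℕₚ.*-monoˡ-≤ (length zs) (ℕₚ.≤ᵇ⇒≤ 4 16 _)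
      large : ¬ length A * length A ≤ p → p ≤ 16 * length zs
      -- With m + 1 = ⌊√p⌋, a subset of that size gives (m + 1)² ≤ 4 |zs|, while p < (m + 2)² ≤ 4 (m
      -- + 1)².
      large n≰p with floor-sqrt p
      ... | zero  , _    , p<1 = contradiction p<1 (ℕₚ.<-asym prime⇒1<p)
      ... | suc m , m²≤p , p<  = begin
        p                                  ≤⟨ ℕₚ.<⇒≤ p< ⟩
        suc (suc m) * suc (suc m)          ≤⟨ ℕₚ.*-mono-≤ (double m) (double m) ⟩
        2 * suc m * (2 * suc m)            ≡⟨ alg (suc m) ⟩
        4 * (suc m * suc m)                ≤⟨ ℕₚ.*-monoʳ-≤ 4 (square-bound (suc m) (s≤s z≤n)
                                               (*-self-cancel-≤ (ℕₚ.≤-trans m²≤p (ℕₚ.<⇒≤ (ℕₚ.≰⇒> n≰p)))) m²≤p) ⟩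
        4 * (4 * length zs)                ≡⟨ ℕₚ.*-assoc 4 4 (length zs) ⟨
        16 * length zs                     ∎
        where
        open ℕₚ.≤-Reasoning
        double : ∀ m → suc (suc m) ≤ 2 * suc m
        double m = subst (suc (suc m) ≤_) (alg′ m) (ℕₚ.m≤m+n (suc (suc m)) m)
          where alg′ : ∀ m → suc (suc m) + m ≡ 2 * suc m
                alg′ = ℕR.solve-∀
        alg : ∀ m → 2 * m * (2 * m) ≡ 4 * (m * m)
        alg = ℕR.solve-∀
      bound : length A ^ 53 ≤ (16 * length zs) ^ 30
      bound with length A * length A ℕ.≤? p
      -- Here |A|² ≤ 16 |zs|, and 53/30 ≤ 2.
      ... | yes n≤p = ^-exponent-≤ {length A} {16 * length zs} {53} {30} {2} {1}
            (subst₂ _≤_ (cong (length A *_) (sym (ℕₚ.*-identityʳ (length A)))) (sym (ℕₚ.*-identityʳ (16 * length zs)))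
              (ℕₚ.≤-trans (square-bound (length A) 0<#A ℕₚ.≤-refl n≤p) 4≤16))
            (ℕₚ.≤ᵇ⇒≤ 53 60 _)
      -- Here |A|^16 ≤ p^9 ≤ (16 |zs|)^9, and 53/30 ≤ 16/9 because 9 · 53 = 477 ≤ 480 = 30 · 16.
      ... | no n≰p = ^-exponent-≤ {length A} {16 * length zs} {53} {30} {16} {9}
            (ℕₚ.≤-trans #A^16≤p^9 (ℕₚ.^-monoˡ-≤ 9 (large n≰p)))
            (ℕₚ.≤ᵇ⇒≤ 477 480 _)

theorem1p7 : Σ ℕ λ K → Σ ℕ λ c →
    (p : ℕ) → (pr : Prime p) → p ≢ 2 →
    (A : List (Fin p)) → Unique A →
    length A ^ 16 ≤ p ^ 9 →
    (length A ^ 53 ≤ K * (cardF2 p pr A ^ 30) * ((1 + ⌈log₂ length A ⌉) ^ c))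
    × (length A ^ 53 ≤ K * (cardG2 p pr A ^ 30) * ((1 + ⌈log₂ length A ⌉) ^ c))
-- K is the constant 16 of `growth` taken out of the 30th power; c = 0 since no logarithm is lost.
theorem1p7 = 16 ^ 30 , 0 , λ p pr _ A uA #A^16≤p^9 →
  subst (length A ^ 53 ≤_) (constant-out (cardF2 p pr A))
    (growth pr uA (cardF2-values pr A) #A^16≤p^9) ,
  subst (length A ^ 53 ≤_) (constant-out (cardG2 p pr A))
    (growth pr uA (cardG2-values pr A) #A^16≤p^9)
  where
  constant-out : ∀ n → (16 * n) ^ 30 ≡ 16 ^ 30 * n ^ 30 * 1
  constant-out n = trans (^-distribʳ-* 30 16 n) (sym (ℕₚ.*-identityʳ (16 ^ 30 * n ^ 30)))
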